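{- If $\Lambda$ is a cyclicity prefix for a rule set $\mathcal{R}$, a head-choice $hc$, and some $\rho\in\mathcal{R}$, then $\Lambda^\infty$ is a cyclicity sequence for the KB $(\mathcal{R},D_\rho)$ and $hc$, and hence $\mathcal{R}$ never-terminates.
   Context: Setting (restricted disjunctive chase). Rules $\rho$: $\forall \vec w,\vec x.[\beta\to \bigvee_{i=1}^n \exists \vec y_i.\eta_i]$ with frontier $\vec x$, $\mathrm{branching}(\rho)=n$; datalog = $n=1$ without existential variables; skolemization $\mathrm{sk}(\rho)$ replaces $y\in\vec y_i$ by $f^\rho_{i,y}(\vec x)$. Trigger $\lambda=(\rho,\sigma)$: loaded for $F$ if $\mathrm{body}(\rho)\sigma\subseteq F$; obsolete for $F$ if some extension $\sigma'$ of $\sigma$ gives $\mathrm{head}_i(\rho)\sigma'\subseteq F$ for some $i$; $\mathrm{out}_i(\lambda)=\mathrm{head}_i(\mathrm{sk}(\rho))\sigma$; $\mathcal{R}$-triggers use rules of $\mathcal{R}$ and substitutions into terms over $\mathrm{sk}(\mathcal{R})$. Chase trees of $(\mathcal{R},D)$ are rooted at $D$, apply loaded non-obsolete $\mathcal{R}$-triggers (datalog first) with one child per disjunct labelled by adding $\mathrm{out}_i(\lambda)$, leaves satisfy all rules, and are fair; $\mathcal{R}$ never-terminates if some KB with $\mathcal{R}$ has no finite chase tree. A head-choice $hc$ picks a disjunct per rule; $\mathrm{out}_{hc}(\lambda)=\mathrm{out}_{hc(\rho)}(\lambda)$; $\mathrm{branch}(T,hc)$ is the branch of $T$ following $hc$.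 $\lambda$ is g-unblockable for KB $K$ and $hc$ if whenever it is loaded for a vertex label on $\mathrm{branch}(T,hc)$ of a chase tree $T$ of $K$, $\mathrm{out}_{hc}(\lambda)$ is in the label of some vertex of that branch. For a sequence $\Lambda=\lambda_1,\lambda_2,\dots$: $F_0=D$, $F_{i+1}=F_i\cup\mathrm{out}_{hc}(\lambda_{i+1})$; loaded if each $\lambda_{i+1}$ is loaded for $F_i$; growing if for each $i$ some $F_j$, $j>i$, has a term not in $F_i$; a cyclicity sequence is loaded, growing, and consists of g-unblockable triggers. Birth facts: $\mathrm{birth}(c)=\emptyset$ for constants; $\mathrm{birth}(f^\psi_{i,v}(\vec s))=\mathrm{out}_i((\psi,\tau))\cup\bigcup_{s}\mathrm{birth}(s)$ where $\tau$ maps $\mathrm{frontier}(\psi)$ to $\vec s$; $\mathrm{birth}((\psi,\tau))=\bigcup_{x\in\mathrm{frontier}(\psi)}\mathrm{birth}(\tau(x))$; $\mathrm{skel}(\lambda)$ = the terms of $\mathrm{birth}(\lambda)$ plus constants assigned to frontier variables. $h^{uc}_\lambda$ maps functional terms $f(\vec t)\notin\mathrm{skel}(\lambda)$ to fresh constants $c_f$, terms of $\mathrm{skel}(\lambda)$ and the $c_f$ to themselves, others to a special constant $\star$. $\mathcal{O}(\mathcal{R},hc,\lambda,h)$ is the minimal fact set containing all facts over predicates of $\mathcal{R}$ and constants in $\mathrm{skel}(\lambda)\cup\{\star\}$, including $\mathrm{birth}(\lambda)$, and including $h(\mathrm{out}_{hc}(\lambda'))$ for every $\mathcal{R}$-trigger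 $\lambda'$ loaded for it with $\mathrm{out}_{hc}(\lambda')\neq\mathrm{out}_{hc}(\lambda)$. $\lambda$ is uc-unblockable for $\mathcal{R}$ and $hc$ if its rule is datalog or it is not obsolete for $\mathcal{O}(\mathcal{R},hc,\lambda,h^{uc}_\lambda)$. A constant mapping $g$ (partial function from constants to terms) is reversible for a subterm-closed set $\mathcal{T}$ if it is defined on all constants of $\mathcal{T}$, injective on $\mathcal{T}$, and no functional $u\in\mathcal{T}$ has $g(u)$ equal to a subterm of $g(c)$ for a constant $c\in\mathcal{T}$. The rule-database of $\rho$ is $D_\rho=\mathrm{body}(\rho)\sigma_{uc}$, where $\sigma_{uc}$ maps each variable $x$ to a fresh constant $c_x$. A term is $\rho$-cyclic if it has the form $f(\vec s)$ with $f$ a function symbol of $\mathrm{sk}(\rho)$ also occurring in $\vec s$. A cyclicity prefix for $\mathcal{R}$, $hc$, $\rho$ is a finite list of $\mathcal{R}$-triggers $\Lambda=(\rho_0,\sigma_0),\dots,(\rho_n,\sigma_n)$ with: $\rho_0=\rho$, $\sigma_0=\sigma_{uc}$; $\Lambda$ loaded for $(\mathcal{R},D_\rho)$ and $hc$; each $(\rho_i,\sigma_i)$, $1\le i\le n$, uc-unblockable for $\mathcal{R}$ and $hc$, and $(\rho_0,\sigma_0)$ g-unblockable; $\rho_n=\rho$ and $\mathrm{out}_{hc}((\rho_n,\sigma_n))$ contains a $\rho$-cyclic term; the constant mapping $g_\Lambda$ with $g_\Lambda\circ\sigma_0=\sigma_n$ is reversible for $\mathrm{skel}((\rho_i,g_\Lambda^j\circ\sigma_i))$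 for all $1\le i\le n$, $j\ge 0$ ($g^0_\Lambda$ the identity). $\Lambda^\infty$ is the infinite sequence $(\rho_0,\sigma_0),(\rho_1,\sigma_1^1),\dots,(\rho_n,\sigma_n^1),(\rho_1,\sigma_1^2),\dots,(\rho_n,\sigma_n^2),\dots$ with $\sigma_i^j=g_\Lambda^{j-1}\circ\sigma_i$. -}

module Defs where

open import Data.Nat using (ℕ; zero; suc; _<_; _≤_; _%_; _/_)
open import Data.Nat.Properties using (_≟_)
open import Data.Bool using (Bool; true; false; if_then_else_)
open import Data.List using (List; []; _∷_; _++_; map; concatMap; length; filter; deduplicate; _∷ʳ_)
open import Data.List.Membership.Propositional using (_∈_)
open import Data.List.Membership.DecPropositional _≟_ using (_∈?_)
open import Data.Maybe using (Maybe; just; nothing; fromMaybe)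
open import Data.Product using (Σ; _×_; _,_; proj₁; proj₂)
open import Data.Sum using (_⊎_)
open import Data.Unit using (⊤)
open import Relation.Nullary using (¬_; does)
open import Relation.Binary.PropositionalEquality using (_≡_)

Var : Set
Var = ℕ

-- an atom: predicate name and argument list (a predicate is identified
-- by its name together with its arity)
record At (A : Set) : Set where
  constructor atom
  field
    pred : ℕ
    args : List A
open At public

VAtom : Set
VAtom = At Var

-- a disjunct  ∃ ys. η  is the pair (ys , η)
Disjunct : Set
Disjunct = List Var × List VAtom

-- ∀ w x. β → ⋁_{i} ∃ y_i. η_i   (disjuncts indexed 0 .. n-1)
record Rule : Set where
  constructor rule
  field
    body  : List VAtom
    heads : List Disjunct
open Rule public

nthD : {A : Set} → A → List A → ℕ → A
nthD d []       _       = d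
nthD d (x ∷ xs) zero    = x
nthD d (x ∷ xs) (suc k) = nthD d xs k

vars : List VAtom → List Var
vars = concatMap args

bodyVars : Rule → List Var
bodyVars ρ = vars (body ρ)

headVars : Rule → List Var
headVars ρ = concatMap (λ d → vars (proj₂ d)) (heads ρ)

frontier : Rule → List Var
frontier ρ = deduplicate _≟_ (filter (λ x → x ∈? headVars ρ) (bodyVars ρ))

branching : Rule → ℕ
branching ρ = length (heads ρ)

disjunct : Rule → ℕ → Disjunct
disjunct ρ i = nthD ([] , []) (heads ρ) i

Datalog : Rule → Set
Datalog ρ = branching ρ ≡ 1 × proj₁ (disjunct ρ 0) ≡ []

WFRule : Rule → Set
WFRule ρ = ∀ {d} → d ∈ heads ρ →
  (∀ {y} → y ∈ proj₁ d → ¬ (y ∈ bodyVars ρ)) ×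
  (∀ {a} → a ∈ proj₂ d → ∀ {v} → v ∈ args a → v ∈ proj₁ d ⊎ v ∈ bodyVars ρ)

FunSym : Set
FunSym = Rule × ℕ × Var

-- constants: ordinary ones, the fresh c_x (variables), the fresh c_f
-- (function symbols) and the special constant ⋆
data Const : Set where
  con  : ℕ → Const
  cvar : Var → Const
  cfun : FunSym → Const
  star : Const

data Term : Set where
  const : Const → Term
  fun   : FunSym → List Term → Term

Atom : Set
Atom = At Term

FactSet : Set₁
FactSet = Atom → Set

⟦_⟧ : List Atom → FactSet
⟦ L ⟧ a = a ∈ L

Subst : Set
Subst = Var → Term

Trigger : Set
Trigger = Rule × Subst

substAtom : Subst → VAtom → Atom
substAtom σ a = atom (pred a) (map σ (args a))

-- term for variable x in head_i(sk(ρ)) σ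
skTerm : Rule → ℕ → List Var → Subst → Var → Term
skTerm ρ i ys σ x =
  if does (x ∈? ys) then fun (ρ , i , x) (map σ (frontier ρ)) else σ x

-- out_i(λ) = head_i(sk(ρ)) σ
out : ℕ → Trigger → List Atom
out i (ρ , σ) =
  map (λ a → atom (pred a) (map (skTerm ρ i (proj₁ (disjunct ρ i)) σ) (args a)))
      (proj₂ (disjunct ρ i))

outhc : (Rule → ℕ) → Trigger → List Atom
outhc hc (ρ , σ) = out (hc ρ) (ρ , σ)

Loaded : Trigger → FactSet → Set
Loaded (ρ , σ) F = ∀ {a} → a ∈ map (substAtom σ) (body ρ) → F a

Obsolete : Trigger → FactSet → Set
Obsolete (ρ , σ) F = Σ Subst λ σ' → (∀ {x} → x ∈ bodyVars ρ → σ' x ≡ σ x) ×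
  Σ ℕ λ i → i < branching ρ × (∀ {a} → a ∈ map (substAtom σ') (proj₂ (disjunct ρ i)) → F a)

data TermOver (R : List Rule) : Term → Set where
  tconst : ∀ c → TermOver R (const c)
  tfun   : ∀ {ρ i y ts} → ρ ∈ R → i < branching ρ → y ∈ proj₁ (disjunct ρ i) →
           length ts ≡ length (frontier ρ) → (∀ {t} → t ∈ ts → TermOver R t) →
           TermOver R (fun (ρ , i , y) ts)

RTrigger : List Rule → Trigger → Set
RTrigger R (ρ , σ) = ρ ∈ R × (∀ {x} → x ∈ bodyVars ρ → TermOver R (σ x))

HeadChoice : List Rule → (Rule → ℕ) → Set
HeadChoice R hc = ∀ {ρ} → ρ ∈ R → hc ρ < branching ρ

Models : List Rule → FactSet → Set
Models R F = ∀ {ρ} → ρ ∈ R → ∀ σ → Loaded (ρ , σ) F → Obsolete (ρ , σ) F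

DatalogModels : List Rule → FactSet → Set
DatalogModels R F = ∀ {ρ} → ρ ∈ R → Datalog ρ → ∀ σ → Loaded (ρ , σ) F → Obsolete (ρ , σ) F

IsConst : Term → Set
IsConst t = Σ Const λ c → t ≡ const c

Database : List Atom → Set
Database D = ∀ {a} → a ∈ D → ∀ {t} → t ∈ args a → IsConst t

-- Chase trees.  Vertices are paths (lists of child indices, the last
-- step first); the child of v via disjunct i is  i ∷ v.

record Tree : Set₁ where
  field
    Vertex : List ℕ → Set
    trig   : List ℕ → Maybe Trigger
open Tree public

outM : ℕ → Maybe Trigger → List Atom
outM i nothing   = []
outM i (just tr) = out i tr

label : List Atom → Tree → List ℕ → List Atom
label D T []      = D
label D T (i ∷ v) = label D T v ++ outM i (trig T v)

record ChaseTree (R : List Rule) (D : List Atom) (T : Tree) : Set where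
  field
    root   : Vertex T []
    parent : ∀ {i v} → Vertex T (i ∷ v) → Vertex T v
    leaf   : ∀ {v} → Vertex T v → trig T v ≡ nothing →
             (∀ i → ¬ Vertex T (i ∷ v)) × Models R ⟦ label D T v ⟧
    inner  : ∀ {v ρ σ} → Vertex T v → trig T v ≡ just (ρ , σ) →
             RTrigger R (ρ , σ) ×
             Loaded (ρ , σ) ⟦ label D T v ⟧ ×
             ¬ Obsolete (ρ , σ) ⟦ label D T v ⟧ ×
             (¬ Datalog ρ → DatalogModels R ⟦ label D T v ⟧) ×
             (∀ i → (Vertex T (i ∷ v) → i < branching ρ) × (i < branching ρ → Vertex T (i ∷ v)))
    fair   : (b : ℕ → List ℕ) → b 0 ≡ [] → (∀ n → Σ ℕ λ k → b (suc n) ≡ k ∷ b n) →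
             (∀ n → Vertex T (b n)) →
             ∀ tr → RTrigger R tr → ∀ n → Loaded tr ⟦ label D T (b n) ⟧ →
             Σ ℕ λ m → n ≤ m × Obsolete tr ⟦ label D T (b m) ⟧

FiniteTree : Tree → Set
FiniteTree T = Σ (List (List ℕ)) λ L → ∀ {v} → Vertex T v → v ∈ L

NeverTerminates : List Rule → Set₁
NeverTerminates R = Σ (List Atom) λ D → Database D ×
  ¬ (Σ Tree λ T → ChaseTree R D T × FiniteTree T)

data OnBranch (hc : Rule → ℕ) (T : Tree) : List ℕ → Set where
  broot : OnBranch hc T []
  bstep : ∀ {v ρ σ} → OnBranch hc T v → trig T v ≡ just (ρ , σ) → OnBranch hc T (hc ρ ∷ v)

GUnblockable : List Rule → List Atom → (Rule → ℕ) → Trigger → Set₁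
GUnblockable R D hc tr = ∀ T → ChaseTree R D T → ∀ {v} → OnBranch hc T v →
  Loaded tr ⟦ label D T v ⟧ →
  Σ (List ℕ) λ w → OnBranch hc T w × (∀ {a} → a ∈ outhc hc tr → a ∈ label D T w)

-- Cyclicity sequences  (Λ i  is  λ_{i+1})

Fseq : List Atom → (Rule → ℕ) → (ℕ → Trigger) → ℕ → List Atom
Fseq D hc Λ zero    = D
Fseq D hc Λ (suc i) = Fseq D hc Λ i ++ outhc hc (Λ i)

TermIn : List Atom → Term → Set
TermIn L t = Σ Atom λ a → a ∈ L × t ∈ args a

CyclicitySequence : List Rule → List Atom → (Rule → ℕ) → (ℕ → Trigger) → Set₁
CyclicitySequence R D hc Λ =
  (∀ i → Loaded (Λ i) ⟦ Fseq D hc Λ i ⟧) ×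
  (∀ i → Σ ℕ λ j → i < j × Σ Term λ t → TermIn (Fseq D hc Λ j) t × ¬ TermIn (Fseq D hc Λ i) t) ×
  (∀ i → GUnblockable R D hc (Λ i))

zipSubst : List Var → List Term → Subst
zipSubst []       _        x = const star
zipSubst (y ∷ ys) []       x = const star
zipSubst (y ∷ ys) (s ∷ ss) x = if does (x ≟ y) then s else zipSubst ys ss x

mutual
  birthT : Term → List Atom
  birthT (const _)           = []
  birthT (fun (ψ , i , v) ss) = out i (ψ , zipSubst (frontier ψ) ss) ++ birthTs ss

  birthTs : List Term → List Atom
  birthTs []       = []
  birthTs (s ∷ ss) = birthT s ++ birthTs ss

birthTrig : Trigger → List Atom
birthTrig (ρ , σ) = concatMap (λ x → birthT (σ x)) (frontier ρ)

Skel : Trigger → Term → Set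
Skel (ρ , σ) t = TermIn (birthTrig (ρ , σ)) t ⊎
  (Σ Var λ x → x ∈ frontier ρ × σ x ≡ t × IsConst t)

IsHuc : Trigger → (Term → Term) → Set
IsHuc tr h = ∀ t →
  (Skel tr t → h t ≡ t) ×
  (∀ f ts → t ≡ fun f ts → ¬ Skel tr t → h t ≡ const (cfun f)) ×
  (∀ f → t ≡ const (cfun f) → h t ≡ t) ×
  (∀ c → t ≡ const c → ¬ Skel tr t → (∀ f → ¬ (c ≡ cfun f)) → h t ≡ const star)

ruleAtoms : Rule → List VAtom
ruleAtoms ρ = body ρ ++ concatMap proj₂ (heads ρ)

PredOf : List Rule → Atom → Set
PredOf R a = Σ Rule λ ρ → ρ ∈ R × Σ VAtom λ b → b ∈ ruleAtoms ρ ×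
  pred b ≡ pred a × length (args b) ≡ length (args a)

SetEq : List Atom → List Atom → Set
SetEq L M = ∀ a → (a ∈ L → a ∈ M) × (a ∈ M → a ∈ L)

mapAtom : (Term → Term) → Atom → Atom
mapAtom h a = atom (pred a) (map h (args a))

data O (R : List Rule) (hc : Rule → ℕ) (tr : Trigger) (h : Term → Term) : Atom → Set where
  base    : ∀ {a} → PredOf R a →
            (∀ {t} → t ∈ args a → Σ Const λ c → t ≡ const c × (Skel tr t ⊎ c ≡ star)) →
            O R hc tr h a
  born    : ∀ {a} → a ∈ birthTrig tr → O R hc tr h a
  derived : ∀ {tr' a} → RTrigger R tr' → Loaded tr' (O R hc tr h) →
            ¬ SetEq (outhc hc tr') (outhc hc tr) →
            a ∈ map (mapAtom h) (outhc hc tr') → O R hc tr h a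

UCUnblockable : List Rule → (Rule → ℕ) → Trigger → Set
UCUnblockable R hc tr = Datalog (proj₁ tr) ⊎
  (∀ h → IsHuc tr h → ¬ Obsolete tr (O R hc tr h))

CMap : Set
CMap = Const → Maybe Term

mutual
  applyC : CMap → Term → Term
  applyC g (const c)  = fromMaybe (const c) (g c)
  applyC g (fun f ts) = fun f (applyCs g ts)

  applyCs : CMap → List Term → List Term
  applyCs g []       = []
  applyCs g (t ∷ ts) = applyC g t ∷ applyCs g ts

iterC : ℕ → CMap → Term → Term
iterC zero    g t = t
iterC (suc j) g t = applyC g (iterC j g t)

data _⊑_ : Term → Term → Set where
  here  : ∀ {t} → t ⊑ t
  under : ∀ {t u f ts} → t ⊑ u → u ∈ ts → t ⊑ fun f ts

Reversible : CMap → (Term → Set) → Set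
Reversible g T =
  (∀ c → T (const c) → Σ Term λ u → g c ≡ just u) ×
  (∀ {t u} → T t → T u → applyC g t ≡ applyC g u → t ≡ u) ×
  (∀ {f ts c} → T (fun f ts) → T (const c) → ¬ (applyC g (fun f ts) ⊑ applyC g (const c)))

σuc : Subst
σuc x = const (cvar x)

Dρ : Rule → List Atom
Dρ ρ = map (substAtom σuc) (body ρ)

FunOf : Rule → FunSym → Set
FunOf ρ (ρ' , i , y) = ρ' ≡ ρ × i < branching ρ × y ∈ proj₁ (disjunct ρ i)

Cyclic : Rule → Term → Set
Cyclic ρ t = Σ FunSym λ f → Σ (List Term) λ ss → t ≡ fun f ss × FunOf ρ f ×
  Σ Term λ s → s ∈ ss × Σ (List Term) λ us → fun f us ⊑ s

LoadedList : (Rule → ℕ) → List Atom → List Trigger → Set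
LoadedList hc F []         = ⊤
LoadedList hc F (tr ∷ trs) = Loaded tr ⟦ F ⟧ × LoadedList hc (F ++ outhc hc tr) trs

-- g_Λ: the constant mapping with domain {c_x | x body variable of ρ}
-- and g_Λ ∘ σ_0 = σ_n
gΛ : Rule → Subst → CMap
gΛ ρ σn (cvar x) = if does (x ∈? bodyVars ρ) then just (σn x) else nothing
gΛ ρ σn _        = nothing

-- Λ = (ρ, σ_uc) , mid , (ρ, σn)
CyclicityPrefix : List Rule → (Rule → ℕ) → Rule → List Trigger → Subst → Set₁
CyclicityPrefix R hc ρ mid σn =
  (∀ {tr} → tr ∈ ((ρ , σuc) ∷ (mid ∷ʳ (ρ , σn))) → RTrigger R tr) ×
  LoadedList hc (Dρ ρ) ((ρ , σuc) ∷ (mid ∷ʳ (ρ , σn))) ×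
  (∀ {tr} → tr ∈ (mid ∷ʳ (ρ , σn)) → UCUnblockable R hc tr) ×
  GUnblockable R (Dρ ρ) hc (ρ , σuc) ×
  (Σ Atom λ a → a ∈ outhc hc (ρ , σn) × Σ Term λ t → t ∈ args a × Cyclic ρ t) ×
  (∀ {tr} → tr ∈ (mid ∷ʳ (ρ , σn)) → ∀ j →
     Reversible (gΛ ρ σn) (Skel (proj₁ tr , λ x → iterC j (gΛ ρ σn) (proj₂ tr x))))

Λ∞ : Rule → List Trigger → Subst → ℕ → Trigger
Λ∞ ρ mid σn zero    = ρ , σuc
Λ∞ ρ mid σn (suc m) =
  proj₁ tr , λ x → iterC (m / suc (length mid)) (gΛ ρ σn) (proj₂ tr x)
  where
  tr : Trigger
  tr = nthD (ρ , σn) mid (m % suc (length mid))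

{-# OPTIONS --safe #-}

-- Let λ = (ρᵢ , σᵢ) be uc-unblockable and G = g^j. Suppose that G ∘ σᵢ is obsolete for a label on
-- branch(T, hc) that lacks its output. Reversibility makes G injective on skel(λ), so there is a partial
-- inverse k of G, which sends the remaining terms to the constants c_f and ⋆. It maps the label into
-- O(R, hc, λ, h_uc): a step introducing some G(u) with u functional yields a birth fact of λ, a step
-- introducing a term visible in some G(c) yields a fact over constants, and any other step is imitated
-- by a derivation in O. So λ is obsolete for O, a contradiction.
-- The sequence grows because every uc-unblockable trigger with existential variables has a functional
-- frontier term, so that all functional terms of the prefix contain every frontier constant of ρ; hence
-- g strictly deepens a functional term σn(x).
module Submission where

open import Defs
open import Data.Bool using (true; false; if_then_else_)
open import Data.Empty using (⊥-elim)
open import Data.List using (List; []; _∷_; _++_; _∷ʳ_; map; concatMap; length)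
open import Data.List.Membership.DecPropositional using () renaming (_∈?_ to decMembership)
open import Data.List.Membership.Propositional using (_∈_; find; lose)
open import Data.List.Membership.Propositional.Properties
  using (∈-map⁺; ∈-map⁻; ∈-++⁺ˡ; ∈-++⁺ʳ; ∈-++⁻; ∈-concatMap⁺; ∈-concatMap⁻; ∈-filter⁺; ∈-filter⁻;
         ∈-deduplicate⁺; ∈-deduplicate⁻)
open import Data.List.Properties using (map-cong-local; map-id; map-∘; length-map; ∷-injectiveˡ; ∷-injectiveʳ)
  renaming (≡-dec to decList)
open import Data.List.Relation.Unary.All as All using ()
open import Data.List.Relation.Unary.Any using (here; there; any?)
open import Data.Maybe using (just; nothing; fromMaybe)
open import Data.Nat using (ℕ; zero; suc; _+_; _*_; _≤_; _<_; _⊔_; z≤n; s≤s; s≤s⁻¹; _%_; _/_)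
open import Data.Nat.DivMod
  using (m≡m%n+[m/n]*n; m%n<n; [m+kn]%n≡m%n; m≤n⇒m%n≡m; +-distrib-/-∣ʳ; m<n⇒m/n≡0; m*n/n≡m)
open import Data.Nat.Divisibility using (n∣m*n)
open import Data.Nat.Properties
open import Data.Product using (Σ; _×_; _,_; proj₁; proj₂)
open import Data.Product.Properties using () renaming (≡-dec to decPair)
open import Data.Sum using (_⊎_; inj₁; inj₂)
open import Function using (_∘_; id)
open import Relation.Binary.Definitions using (DecidableEquality)
open import Relation.Binary.PropositionalEquality
  using (_≡_; refl; sym; trans; cong; cong₂; subst; module ≡-Reasoning)
open import Relation.Nullary using (¬_; Dec; yes; no; does; contradiction; ¬?)
open import Relation.Nullary.Decidable using (map′; _×-dec_; _⊎-dec_; dec-true; dec-false; decidable-stable)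

private
  variable
    A B : Set
    x y z : Var
    t u w : Term
    σ τ : Subst

-- Decidable equality of rules, terms and facts; membership in lists.

_∈v?_ : (x : Var) (xs : List Var) → Dec (x ∈ xs)
_∈v?_ = decMembership _≟_

decAt : DecidableEquality A → DecidableEquality (At A)
decAt _≟A_ (atom p ss) (atom q ts) =
  map′ (λ { (refl , refl) → refl }) (λ { refl → refl , refl }) ((p ≟ q) ×-dec decList _≟A_ ss ts)

_≟Rule_ : DecidableEquality Rule
rule b hs ≟Rule rule b' hs' =
  map′ (λ { (refl , refl) → refl }) (λ { refl → refl , refl })
    (decList (decAt _≟_) b b' ×-dec decList (decPair (decList _≟_) (decList (decAt _≟_))) hs hs')

_≟Fun_ : DecidableEquality FunSym
_≟Fun_ = decPair _≟Rule_ (decPair _≟_ _≟_)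

_≟Const_ : DecidableEquality Const
con m  ≟Const con n  = map′ (cong con) (λ { refl → refl }) (m ≟ n)
con _  ≟Const cvar _ = no λ ()
con _  ≟Const cfun _ = no λ ()
con _  ≟Const star   = no λ ()
cvar _ ≟Const con _  = no λ ()
cvar x ≟Const cvar y = map′ (cong cvar) (λ { refl → refl }) (x ≟ y)
cvar _ ≟Const cfun _ = no λ ()
cvar _ ≟Const star   = no λ ()
cfun _ ≟Const con _  = no λ ()
cfun _ ≟Const cvar _ = no λ ()
cfun f ≟Const cfun g = map′ (cong cfun) (λ { refl → refl }) (f ≟Fun g)
cfun _ ≟Const star   = no λ ()
star   ≟Const con _  = no λ ()
star   ≟Const cvar _ = no λ ()
star   ≟Const cfun _ = no λ ()
star   ≟Const star   = yes refl

mutual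
  _≟Term_ : DecidableEquality Term
  const c  ≟Term const d  = map′ (cong const) (λ { refl → refl }) (c ≟Const d)
  const _  ≟Term fun _ _  = no λ ()
  fun _ _  ≟Term const _  = no λ ()
  fun f ss ≟Term fun g ts =
    map′ (λ { (refl , refl) → refl }) (λ { refl → refl , refl }) ((f ≟Fun g) ×-dec (ss ≟Terms ts))

  _≟Terms_ : DecidableEquality (List Term)
  []       ≟Terms []       = yes refl
  []       ≟Terms (_ ∷ _)  = no λ ()
  (_ ∷ _)  ≟Terms []       = no λ ()
  (s ∷ ss) ≟Terms (t ∷ ts) =
    map′ (λ { (refl , refl) → refl }) (λ { refl → refl , refl }) ((s ≟Term t) ×-dec (ss ≟Terms ts))

_∈atoms?_ : (a : Atom) (L : List Atom) → Dec (a ∈ L)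
_∈atoms?_ = decMembership (decAt _≟Term_)

isConst? : (t : Term) → Dec (IsConst t)
isConst? (const c) = yes (c , refl)
isConst? (fun _ _) = no λ { (_ , ()) }

fun-injˡ : ∀ {f g ss ts} → fun f ss ≡ fun g ts → f ≡ g
fun-injˡ refl = refl

fun-injʳ : ∀ {f g ss ts} → fun f ss ≡ fun g ts → ss ≡ ts
fun-injʳ refl = refl

map-cong-∈ : {f g : A → B} (xs : List A) → (∀ {x} → x ∈ xs → f x ≡ g x) → map f xs ≡ map g xs
map-cong-∈ xs eq = map-cong-local (All.tabulate eq)

map-≡-∈ : {f g : A → B} (xs : List A) → map f xs ≡ map g xs → ∀ {x} → x ∈ xs → f x ≡ g x
map-≡-∈ (x ∷ xs) eq (here refl) = ∷-injectiveˡ eq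
map-≡-∈ (x ∷ xs) eq (there x∈)  = map-≡-∈ xs (∷-injectiveʳ eq) x∈

concatMap⁺ : {f : A → List B} {xs : List A} {a : A} {b : B} → a ∈ xs → b ∈ f a → b ∈ concatMap f xs
concatMap⁺ {f = f} a∈ b∈ = ∈-concatMap⁺ f (lose a∈ b∈)

concatMap⁻ : {f : A → List B} {xs : List A} {b : B} → b ∈ concatMap f xs → Σ A λ a → a ∈ xs × b ∈ f a
concatMap⁻ {f = f} b∈ = find (∈-concatMap⁻ f b∈)

-- Skolemized heads, homomorphic maps and loadedness.

headVarsAt : Rule → ℕ → List Var
headVarsAt ψ i = vars (proj₂ (disjunct ψ i))

exVarsAt : Rule → ℕ → List Var
exVarsAt ψ i = proj₁ (disjunct ψ i)

sk : Rule → ℕ → Subst → Var → Term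
sk ψ i = skTerm ψ i (exVarsAt ψ i)

frontier⊆body : ∀ ψ → x ∈ frontier ψ → x ∈ bodyVars ψ
frontier⊆body ψ x∈ = proj₁ (∈-filter⁻ (λ x → x ∈v? headVars ψ) (∈-deduplicate⁻ _≟_ _ x∈))

disjunct∈ : ∀ ψ {i} → i < branching ψ → disjunct ψ i ∈ heads ψ
disjunct∈ ψ = go (heads ψ)
  where
  go : ∀ ds {i} → i < length ds → nthD ([] , []) ds i ∈ ds
  go (d ∷ ds) {zero}  _       = here refl
  go (d ∷ ds) {suc i} (s≤s p) = there (go ds p)

body∩head⊆frontier : ∀ ψ {i} → i < branching ψ → x ∈ bodyVars ψ → x ∈ headVarsAt ψ i → x ∈ frontier ψ
body∩head⊆frontier ψ i< x∈b x∈h =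
  ∈-deduplicate⁺ _≟_ (∈-filter⁺ (λ x → x ∈v? headVars ψ) x∈b (concatMap⁺ (disjunct∈ ψ i<) x∈h))

sk-ex : ∀ ψ i σ → z ∈ exVarsAt ψ i → sk ψ i σ z ≡ fun (ψ , i , z) (map σ (frontier ψ))
sk-ex {z} ψ i σ z∈ = cong (λ b → if b then fun (ψ , i , z) (map σ (frontier ψ)) else σ z)
  (dec-true (z ∈v? exVarsAt ψ i) z∈)

sk-fr : ∀ ψ i σ → ¬ z ∈ exVarsAt ψ i → sk ψ i σ z ≡ σ z
sk-fr {z} ψ i σ z∉ = cong (λ b → if b then fun (ψ , i , z) (map σ (frontier ψ)) else σ z)
  (dec-false (z ∈v? exVarsAt ψ i) z∉)

outAtom : Rule → ℕ → Subst → VAtom → Atom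
outAtom ψ i σ b = atom (pred b) (map (sk ψ i σ) (args b))

termIn-out⁺ : ∀ ψ i σ → z ∈ headVarsAt ψ i → TermIn (out i (ψ , σ)) (sk ψ i σ z)
termIn-out⁺ ψ i σ z∈ with concatMap⁻ {f = args} z∈
... | b , b∈ , z∈b = outAtom ψ i σ b , ∈-map⁺ (outAtom ψ i σ) b∈ , ∈-map⁺ (sk ψ i σ) z∈b

termIn-out⁻ : ∀ ψ i σ → TermIn (out i (ψ , σ)) t → Σ Var λ z → z ∈ headVarsAt ψ i × t ≡ sk ψ i σ z
termIn-out⁻ ψ i σ (a , a∈ , t∈) with ∈-map⁻ (outAtom ψ i σ) a∈
... | b , b∈ , refl with ∈-map⁻ (sk ψ i σ) t∈
...   | z , z∈ , eq = z , concatMap⁺ b∈ z∈ , eq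

Hom : (Term → Term) → Set
Hom G = ∀ f ts → G (fun f ts) ≡ fun f (map G ts)

sk-hom : ∀ {G} → Hom G → ∀ ψ i σ z → G (sk ψ i σ z) ≡ sk ψ i (G ∘ σ) z
sk-hom {G} hom ψ i σ z with z ∈v? exVarsAt ψ i
... | yes _ = trans (hom _ _) (cong (fun (ψ , i , z)) (sym (map-∘ (frontier ψ))))
... | no  _ = refl

out-hom : ∀ {G} → Hom G → ∀ ψ i σ → map (mapAtom G) (out i (ψ , σ)) ≡ out i (ψ , G ∘ σ)
out-hom {G} hom ψ i σ = trans (sym (map-∘ (proj₂ (disjunct ψ i))))
  (map-cong-∈ (proj₂ (disjunct ψ i)) λ {b} _ →
    cong (atom (pred b)) (trans (sym (map-∘ (args b))) (map-cong-∈ (args b) λ {z} _ → sk-hom hom ψ i σ z)))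

map-out-cong : ∀ ψ i {G : Term → Term} → (∀ {z} → z ∈ headVarsAt ψ i → G (sk ψ i σ z) ≡ sk ψ i τ z) →
               map (mapAtom G) (out i (ψ , σ)) ≡ out i (ψ , τ)
map-out-cong ψ i eq = trans (sym (map-∘ (proj₂ (disjunct ψ i))))
  (map-cong-∈ (proj₂ (disjunct ψ i)) λ {b} b∈ →
    cong (atom (pred b)) (trans (sym (map-∘ (args b))) (map-cong-∈ (args b) λ z∈ → eq (concatMap⁺ b∈ z∈))))

zipSubst-map : ∀ xs σ → x ∈ xs → zipSubst xs (map σ xs) x ≡ σ x
zipSubst-map {x} (y ∷ xs) σ x∈ = by-cases (x ≟ y) x∈
  where
  rest : Term
  rest = zipSubst xs (map σ xs) x

  by-cases : Dec (x ≡ y) → x ∈ y ∷ xs → (if does (x ≟ y) then σ y else rest) ≡ σ x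
  by-cases (yes x≡y) _ =
    trans (cong (λ b → if b then σ y else rest) (dec-true (x ≟ y) x≡y)) (cong σ (sym x≡y))
  by-cases (no x≢y) (here x≡y)   = contradiction x≡y x≢y
  by-cases (no x≢y) (there x∈xs) =
    trans (cong (λ b → if b then σ y else rest) (dec-false (x ≟ y) x≢y)) (zipSubst-map xs σ x∈xs)

applyCs≡map : ∀ g ts → applyCs g ts ≡ map (applyC g) ts
applyCs≡map g []       = refl
applyCs≡map g (t ∷ ts) = cong (applyC g t ∷_) (applyCs≡map g ts)

applyC-hom : ∀ g → Hom (applyC g)
applyC-hom g f ts = cong (fun f) (applyCs≡map g ts)

iterC-hom : ∀ j g → Hom (iterC j g)
iterC-hom zero    g f ts = cong (fun f) (sym (map-id ts))
iterC-hom (suc j) g f ts = trans (cong (applyC g) (iterC-hom j g f ts))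
  (trans (applyC-hom g f _) (cong (fun f) (sym (map-∘ ts))))

iterC-suc : ∀ j g t → iterC (suc j) g t ≡ iterC j g (applyC g t)
iterC-suc zero    g t = refl
iterC-suc (suc j) g t = cong (applyC g) (iterC-suc j g t)

loaded-mono : ∀ {tr} {F F' : FactSet} → (∀ {a} → F a → F' a) → Loaded tr F → Loaded tr F'
loaded-mono {ρ , σ} F⊆F' l a∈ = F⊆F' (l a∈)

loaded-term : ∀ {ψ σ L} → Loaded (ψ , σ) ⟦ L ⟧ → x ∈ bodyVars ψ → TermIn L (σ x)
loaded-term {ψ = ψ} {σ} l x∈ with concatMap⁻ {f = args} {body ψ} x∈
... | b , b∈ , x∈b = substAtom σ b , l (∈-map⁺ (substAtom σ) b∈) , ∈-map⁺ σ x∈b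

loaded-map : ∀ {ψ σ F F'} (k : Term → Term) → (∀ {a} → F a → F' (mapAtom k a)) →
             Loaded (ψ , σ) F → Loaded (ψ , k ∘ σ) F'
loaded-map {ψ} {σ} {F} {F'} k F→F' l a∈ with ∈-map⁻ (substAtom (k ∘ σ)) a∈
... | b , b∈ , refl =
  subst F' (cong (atom (pred b)) (sym (map-∘ (args b)))) (F→F' (l (∈-map⁺ (substAtom σ) b∈)))

-- Birth facts and visible terms.

birthTs≡ : ∀ ts → birthTs ts ≡ concatMap birthT ts
birthTs≡ []       = refl
birthTs≡ (t ∷ ts) = cong (birthT t ++_) (birthTs≡ ts)

-- The terms visible in t: in contrast to the terms of birth(t), an argument f(..., s, ...) is only
-- followed if its variable occurs in the disjunct that introduces f. Skel is closed under visible
-- terms, but not under subterms.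
mutual
  vis : Term → List Term
  vis (const c)            = const c ∷ []
  vis (fun (ψ , i , y) ss) =
    concatMap args (out i (ψ , zipSubst (frontier ψ) ss)) ++ visArgs (headVarsAt ψ i) (frontier ψ) ss

  visArgs : List Var → List Var → List Term → List Term
  visArgs H (x ∷ xs) (s ∷ ss) = (if does (x ∈v? H) then vis s else []) ++ visArgs H xs ss
  visArgs H _        _        = []

visArgs⁻ : ∀ H xs σ → t ∈ visArgs H xs (map σ xs) → Σ Var λ x → x ∈ xs × x ∈ H × t ∈ vis (σ x)
visArgs⁻ H (x ∷ xs) σ t∈ with x ∈v? H
... | no _ = let y , y∈ , r = visArgs⁻ H xs σ t∈ in y , there y∈ , r
... | yes x∈H with ∈-++⁻ (vis (σ x)) t∈
...   | inj₁ t∈x = x , here refl , x∈H , t∈x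
...   | inj₂ t∈  = let y , y∈ , r = visArgs⁻ H xs σ t∈ in y , there y∈ , r

visArgs⁺ : ∀ H xs σ → x ∈ xs → x ∈ H → t ∈ vis (σ x) → t ∈ visArgs H xs (map σ xs)
visArgs⁺ H (x ∷ xs) σ (here refl) x∈H t∈ with x ∈v? H
... | yes _   = ∈-++⁺ˡ t∈
... | no  x∉H = contradiction x∈H x∉H
visArgs⁺ H (y ∷ xs) σ (there x∈) x∈H t∈ with y ∈v? H
... | yes _ = ∈-++⁺ʳ (vis (σ y)) (visArgs⁺ H xs σ x∈ x∈H t∈)
... | no  _ = visArgs⁺ H xs σ x∈ x∈H t∈

-- Terms arising along the branch, their birth facts and visible terms.

module Chase {R : List Rule} {hc : Rule → ℕ} (wf : ∀ {ψ} → ψ ∈ R → WFRule ψ) (hch : HeadChoice R hc) where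

  private
    variable
      ψ : Rule
      i j : ℕ

  ex∉body : ψ ∈ R → i < branching ψ → y ∈ exVarsAt ψ i → ¬ y ∈ bodyVars ψ
  ex∉body {ψ} ψ∈ i< = proj₁ (wf ψ∈ (disjunct∈ ψ i<))

  -- By well-formedness a head variable that is not existential occurs in the body, hence in the
  -- frontier. The later case splits on output terms rest on this.
  head-cases : ψ ∈ R → i < branching ψ → z ∈ headVarsAt ψ i →
               z ∈ exVarsAt ψ i ⊎ (¬ z ∈ exVarsAt ψ i × z ∈ frontier ψ)
  head-cases {ψ} {i} {z} ψ∈ i< z∈ with z ∈v? exVarsAt ψ i
  ... | yes z∈ex = inj₁ z∈ex
  ... | no  z∉ex with concatMap⁻ {f = args} z∈
  ...   | b , b∈ , z∈b with proj₂ (wf ψ∈ (disjunct∈ ψ i<)) b∈ z∈b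
  ...     | inj₁ z∈ex = contradiction z∈ex z∉ex
  ...     | inj₂ z∈bd = inj₂ (z∉ex , body∩head⊆frontier ψ i< z∈bd z∈)

  sk-elim : (P : Term → Set) → ψ ∈ R → i < branching ψ → z ∈ headVarsAt ψ i →
            (z ∈ exVarsAt ψ i → P (fun (ψ , i , z) (map σ (frontier ψ)))) →
            (z ∈ frontier ψ → P (σ z)) → P (sk ψ i σ z)
  sk-elim {ψ} {i} {z} {σ} P ψ∈ i< z∈ pe pf with head-cases ψ∈ i< z∈
  ... | inj₁ z∈ex          = subst P (sym (sk-ex ψ i σ z∈ex)) (pe z∈ex)
  ... | inj₂ (z∉ex , z∈fr) = subst P (sym (sk-fr ψ i σ z∉ex)) (pf z∈fr)

  sk-frontier : ψ ∈ R → i < branching ψ → z ∈ frontier ψ → sk ψ i σ z ≡ σ z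
  sk-frontier {ψ} {i} {σ = σ} ψ∈ i< z∈ =
    sk-fr ψ i σ λ z∈ex → ex∉body ψ∈ i< z∈ex (frontier⊆body ψ z∈)

  sk-cong : ψ ∈ R → i < branching ψ → (∀ {x} → x ∈ frontier ψ → σ x ≡ τ x) →
            z ∈ headVarsAt ψ i → sk ψ i σ z ≡ sk ψ i τ z
  sk-cong {ψ} {i} {σ} {τ} {z} ψ∈ i< eq z∈ = sym (sk-elim (λ t → sk ψ i τ z ≡ t) ψ∈ i< z∈
    (λ z∈ex → trans (sk-ex ψ i τ z∈ex)
                (cong (fun (ψ , i , z)) (map-cong-∈ (frontier ψ) λ x∈ → sym (eq x∈))))
    (λ z∈fr → trans (sk-frontier ψ∈ i< z∈fr) (sym (eq z∈fr))))

  out-cong : ψ ∈ R → i < branching ψ → (∀ {x} → x ∈ frontier ψ → σ x ≡ τ x) →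
             out i (ψ , σ) ≡ out i (ψ , τ)
  out-cong {ψ} {i} ψ∈ i< eq = map-cong-∈ (proj₂ (disjunct ψ i)) λ {b} b∈ →
    cong (atom (pred b)) (map-cong-∈ (args b) λ z∈ → sk-cong ψ∈ i< eq (concatMap⁺ b∈ z∈))

  -- The terms that can occur in the labels along branch(T, hc) for the rule-database.
  data Good : Term → Set where
    cvarG : Good (const (cvar x))
    funG  : ∀ {ss} τ → ψ ∈ R → i ≡ hc ψ → y ∈ exVarsAt ψ i → y ∈ headVarsAt ψ i →
            ss ≡ map τ (frontier ψ) → (∀ {x} → x ∈ frontier ψ → Good (τ x)) → Good (fun (ψ , i , y) ss)

  hc< : ψ ∈ R → i ≡ hc ψ → i < branching ψ
  hc< ψ∈ refl = hch ψ∈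

  out-zipSubst : ∀ ψ i τ → ψ ∈ R → i < branching ψ →
                 out i (ψ , zipSubst (frontier ψ) (map τ (frontier ψ))) ≡ out i (ψ , τ)
  out-zipSubst ψ i τ ψ∈ i< = out-cong ψ∈ i< (zipSubst-map (frontier ψ) τ)

  sk-good : ψ ∈ R → i ≡ hc ψ → (∀ {x} → x ∈ frontier ψ → Good (σ x)) →
            z ∈ headVarsAt ψ i → Good (sk ψ i σ z)
  sk-good {σ = σ} ψ∈ i≡ good z∈ = sk-elim Good ψ∈ (hc< ψ∈ i≡) z∈
    (λ z∈ex → funG σ ψ∈ i≡ z∈ex z∈ refl good) good

  good-args : Good (fun (ψ , i , y) (map σ (frontier ψ))) → x ∈ frontier ψ → Good (σ x)
  good-args {ψ} (funG τ _ _ _ _ eq good) x∈ = subst Good (sym (map-≡-∈ (frontier ψ) eq x∈)) (good x∈)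

  good-applyC : ∀ {g} → (∀ x → Good (applyC g (const (cvar x)))) → Good t → Good (applyC g t)
  good-applyC gg (cvarG {x}) = gg x
  good-applyC {g = g} gg (funG {ψ} τ ψ∈ i≡ y∈ex y∈ refl good) =
    funG (applyC g ∘ τ) ψ∈ i≡ y∈ex y∈ (trans (applyCs≡map g _) (sym (map-∘ (frontier ψ))))
      (λ x∈ → good-applyC gg (good x∈))

  good-iterC : ∀ {g} → (∀ x → Good (applyC g (const (cvar x)))) → ∀ j → Good t → Good (iterC j g t)
  good-iterC gg zero    good = good
  good-iterC gg (suc j) good = good-applyC gg (good-iterC gg j good)

  good-termOver : Good t → TermOver R t
  good-termOver cvarG = tconst _
  good-termOver (funG {ψ} τ ψ∈ i≡ y∈ex y∈ refl good) =
    tfun ψ∈ (hc< ψ∈ i≡) y∈ex (length-map τ (frontier ψ)) over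
    where
    over : t ∈ map τ (frontier ψ) → TermOver R t
    over t∈ with ∈-map⁻ τ t∈
    ... | x , x∈ , refl = good-termOver (good x∈)

  birth⁻ : ∀ ψ i y τ {a} → ψ ∈ R → i ≡ hc ψ → a ∈ birthT (fun (ψ , i , y) (map τ (frontier ψ))) →
           a ∈ out i (ψ , τ) ⊎ Σ Var λ x → x ∈ frontier ψ × a ∈ birthT (τ x)
  birth⁻ ψ i y τ {a} ψ∈ i≡ a∈ with ∈-++⁻ (out i (ψ , zipSubst (frontier ψ) (map τ (frontier ψ)))) a∈
  ... | inj₁ a∈out = inj₁ (subst (a ∈_) (out-zipSubst ψ i τ ψ∈ (hc< ψ∈ i≡)) a∈out)
  ... | inj₂ a∈bs with concatMap⁻ {f = birthT} (subst (a ∈_) (birthTs≡ (map τ (frontier ψ))) a∈bs)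
  ...   | t , t∈ , a∈t with ∈-map⁻ τ t∈
  ...     | x , x∈ , refl = inj₂ (x , x∈ , a∈t)

  birth-out : ∀ ψ i y τ {a} → ψ ∈ R → i ≡ hc ψ → a ∈ out i (ψ , τ) →
              a ∈ birthT (fun (ψ , i , y) (map τ (frontier ψ)))
  birth-out ψ i y τ {a} ψ∈ i≡ a∈ = ∈-++⁺ˡ (subst (a ∈_) (sym (out-zipSubst ψ i τ ψ∈ (hc< ψ∈ i≡))) a∈)

  birth-arg : ∀ ψ i y τ {a} → x ∈ frontier ψ → a ∈ birthT (τ x) →
              a ∈ birthT (fun (ψ , i , y) (map τ (frontier ψ)))
  birth-arg ψ i y τ {a} x∈ a∈ = ∈-++⁺ʳ _
    (subst (a ∈_) (sym (birthTs≡ (map τ (frontier ψ)))) (concatMap⁺ (∈-map⁺ τ x∈) a∈))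

  birth-good : Good w → TermIn (birthT w) t → Good t
  birth-good (funG {ψ} {i} {y} τ ψ∈ i≡ y∈ex y∈ refl good) (a , a∈ , t∈) with birth⁻ ψ i y τ ψ∈ i≡ a∈
  ... | inj₂ (x , x∈ , a∈x) = birth-good (good x∈) (a , a∈x , t∈)
  ... | inj₁ a∈out with termIn-out⁻ ψ i τ (a , a∈out , t∈)
  ...   | z , z∈ , refl = sk-good ψ∈ i≡ good z∈

  birth-trans : ∀ {f ss a} → Good w → TermIn (birthT w) (fun f ss) → a ∈ birthT (fun f ss) → a ∈ birthT w
  birth-trans {f = f} {ss} {a} (funG {ψ} {i} {y} τ ψ∈ i≡ y∈ex y∈ refl good) (b , b∈ , t∈) a∈
    with birth⁻ ψ i y τ ψ∈ i≡ b∈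
  ... | inj₂ (x , x∈ , b∈x) = birth-arg ψ i y τ x∈ (birth-trans (good x∈) (b , b∈x , t∈) a∈)
  ... | inj₁ b∈out with termIn-out⁻ ψ i τ (b , b∈out , t∈)
  ...   | z , z∈ , eq = sk-elim {σ = τ} (λ t → fun f ss ≡ t → a ∈ birthT (fun (ψ , i , y) (map τ (frontier ψ))))
            ψ∈ (hc< ψ∈ i≡) z∈
            -- `birthT` ignores the existential variable, so siblings created by the same disjunct
            -- on the same arguments share their birth facts by definition.
            (λ _ eq → subst (λ t → a ∈ birthT t) eq a∈)
            (λ z∈fr eq → birth-arg ψ i y τ z∈fr (subst (λ t → a ∈ birthT t) eq a∈))
            eq

  -- `Good` demands that the existential variable occurs in its disjunct, so the output that creates
  -- the term also mentions it.
  birth-self : ∀ {f ss} → Good (fun f ss) → TermIn (birthT (fun f ss)) (fun f ss)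
  birth-self (funG {ψ} {i} {y} τ ψ∈ i≡ y∈ex y∈ refl good) with termIn-out⁺ ψ i τ y∈
  ... | a , a∈ , t∈ = a , birth-out ψ i y τ ψ∈ i≡ a∈ , subst (_∈ args a) (sk-ex ψ i τ y∈ex) t∈

  Visible : Rule → ℕ → Subst → Term → Set
  Visible ψ i τ t = (Σ Var λ z → z ∈ headVarsAt ψ i × t ≡ sk ψ i τ z) ⊎
    (Σ Var λ x → x ∈ frontier ψ × x ∈ headVarsAt ψ i × t ∈ vis (τ x))

  vis⁻ : ∀ ψ i y τ → ψ ∈ R → i ≡ hc ψ → t ∈ vis (fun (ψ , i , y) (map τ (frontier ψ))) → Visible ψ i τ t
  vis⁻ {t} ψ i y τ ψ∈ i≡ t∈
    with ∈-++⁻ (concatMap args (out i (ψ , zipSubst (frontier ψ) (map τ (frontier ψ))))) t∈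
  ... | inj₂ t∈args = inj₂ (visArgs⁻ _ (frontier ψ) τ t∈args)
  ... | inj₁ t∈out =
    inj₁ (termIn-out⁻ ψ i τ
      (subst (λ L → TermIn L t) (out-zipSubst ψ i τ ψ∈ (hc< ψ∈ i≡)) (concatMap⁻ {f = args} t∈out)))

  vis⁺ : ∀ ψ i y τ → ψ ∈ R → i ≡ hc ψ → Visible ψ i τ t → t ∈ vis (fun (ψ , i , y) (map τ (frontier ψ)))
  vis⁺ ψ i y τ ψ∈ i≡ (inj₁ (z , z∈ , refl))
    with subst (λ L → TermIn L (sk ψ i τ z)) (sym (out-zipSubst ψ i τ ψ∈ (hc< ψ∈ i≡))) (termIn-out⁺ ψ i τ z∈)
  ... | a , a∈ , t∈ = ∈-++⁺ˡ (concatMap⁺ {f = args} a∈ t∈)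
  vis⁺ ψ i y τ ψ∈ i≡ (inj₂ (x , x∈ , x∈H , t∈)) = ∈-++⁺ʳ _ (visArgs⁺ _ (frontier ψ) τ x∈ x∈H t∈)

  vis-self : Good w → w ∈ vis w
  vis-self cvarG = here refl
  vis-self (funG {ψ} {i} {y} τ ψ∈ i≡ y∈ex y∈ refl good) =
    vis⁺ ψ i y τ ψ∈ i≡ (inj₁ (y , y∈ , sym (sk-ex ψ i τ y∈ex)))

  vis-trans : Good w → u ∈ vis w → t ∈ vis u → t ∈ vis w
  vis-trans cvarG (here refl) t∈ = t∈
  vis-trans {u = u} {t} (funG {ψ} {i} {y} τ ψ∈ i≡ y∈ex y∈ refl good) u∈ t∈ with vis⁻ ψ i y τ ψ∈ i≡ u∈
  ... | inj₂ (x , x∈ , x∈H , u∈x) = vis⁺ ψ i y τ ψ∈ i≡ (inj₂ (x , x∈ , x∈H , vis-trans (good x∈) u∈x t∈))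
  ... | inj₁ (z , z∈ , refl) =
    sk-elim {σ = τ} (λ u → t ∈ vis u → t ∈ vis (fun (ψ , i , y) (map τ (frontier ψ)))) ψ∈ (hc< ψ∈ i≡) z∈
      (λ _ t∈ → vis⁺ ψ i y τ ψ∈ i≡ (vis⁻ ψ i z τ ψ∈ i≡ t∈))
      (λ z∈fr t∈ → vis⁺ ψ i y τ ψ∈ i≡ (inj₂ (z , z∈fr , z∈ , t∈)))
      t∈

  -- Up to exchanging the existential variable within one disjunct, visible terms are subterms.
  vis-sub : Good w → t ∈ vis w → t ⊑ w ⊎
    (Σ Rule λ ψ → Σ ℕ λ i → Σ Var λ y → Σ Var λ z → Σ (List Term) λ ss →
      t ≡ fun (ψ , i , z) ss × fun (ψ , i , y) ss ⊑ w × y ∈ exVarsAt ψ i × y ∈ headVarsAt ψ i)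
  vis-sub cvarG (here refl) = inj₁ here
  vis-sub {t = t} (funG {ψ} {i} {y} τ ψ∈ i≡ y∈ex y∈ refl good) t∈ with vis⁻ ψ i y τ ψ∈ i≡ t∈
  ... | inj₂ (x , x∈ , x∈H , t∈x) with vis-sub (good x∈) t∈x
  ...   | inj₁ t⊑ = inj₁ (under t⊑ (∈-map⁺ τ x∈))
  ...   | inj₂ (ψ' , i' , y' , z' , ss , eq , f⊑ , r) =
    inj₂ (ψ' , i' , y' , z' , ss , eq , under f⊑ (∈-map⁺ τ x∈) , r)
  vis-sub {t = t} (funG {ψ} {i} {y} τ ψ∈ i≡ y∈ex y∈ refl good) t∈ | inj₁ (z , z∈ , refl)
    with head-cases ψ∈ (hc< ψ∈ i≡) z∈
  ... | inj₁ z∈ex = inj₂ (ψ , i , y , z , _ , sk-ex ψ i τ z∈ex , here , y∈ex , y∈)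
  ... | inj₂ (z∉ex , z∈fr) =
    inj₁ (subst (_⊑ _) (sym (sk-fr ψ i τ z∉ex)) (under here (∈-map⁺ τ z∈fr)))

  -- Applying `g` only replaces constants, so what is visible afterwards either stems from a visible
  -- term of `w` or lies inside the term that replaced a visible constant. This drives the induction
  -- in `sep^`.
  vis-applyC : ∀ {g} → (∀ x → Good (applyC g (const (cvar x)))) → Good w → t ∈ vis (applyC g w) →
    (Σ Term λ u → u ∈ vis w × t ≡ applyC g u) ⊎
    (Σ Var λ x → const (cvar x) ∈ vis w × t ∈ vis (applyC g (const (cvar x))))
  vis-applyC gg (cvarG {x}) t∈ = inj₂ (x , here refl , t∈)
  vis-applyC {t = t} {g} gg (funG {ψ} {i} {y} τ ψ∈ i≡ y∈ex y∈ refl good) t∈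
    with vis⁻ ψ i y (applyC g ∘ τ) ψ∈ i≡
           (subst (λ ss → t ∈ vis (fun (ψ , i , y) ss)) (trans (applyCs≡map g _) (sym (map-∘ (frontier ψ)))) t∈)
  ... | inj₁ (z , z∈ , eq) =
    inj₁ (sk ψ i τ z , vis⁺ ψ i y τ ψ∈ i≡ (inj₁ (z , z∈ , refl)) ,
          trans eq (sym (sk-hom (applyC-hom g) ψ i τ z)))
  ... | inj₂ (x , x∈ , x∈H , t∈x) with vis-applyC gg (good x∈) t∈x
  ...   | inj₁ (u , u∈ , eq)  = inj₁ (u , vis⁺ ψ i y τ ψ∈ i≡ (inj₂ (x , x∈ , x∈H , u∈)) , eq)
  ...   | inj₂ (x' , c∈ , t∈) = inj₂ (x' , vis⁺ ψ i y τ ψ∈ i≡ (inj₂ (x , x∈ , x∈H , c∈)) , t∈)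

  birth-applyC : ∀ {g a} → Good w → a ∈ birthT w → mapAtom (applyC g) a ∈ birthT (applyC g w)
  birth-applyC {g = g} {a} (funG {ψ} {i} {y} τ ψ∈ i≡ y∈ex y∈ refl good) a∈ =
    subst (λ ss → mapAtom (applyC g) a ∈ birthT (fun (ψ , i , y) ss))
      (trans (map-∘ (frontier ψ)) (sym (applyCs≡map g _))) image
    where
    image : mapAtom (applyC g) a ∈ birthT (fun (ψ , i , y) (map (applyC g ∘ τ) (frontier ψ)))
    image with birth⁻ ψ i y τ ψ∈ i≡ a∈
    ... | inj₁ a∈out = birth-out ψ i y (applyC g ∘ τ) ψ∈ i≡
      (subst (mapAtom (applyC g) a ∈_) (out-hom (applyC-hom g) ψ i τ) (∈-map⁺ (mapAtom (applyC g)) a∈out))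
    ... | inj₂ (x , x∈ , a∈x) = birth-arg ψ i y (applyC g ∘ τ) x∈ (birth-applyC (good x∈) a∈x)

  -- Closure properties of skeletons.

  module Skeleton (ρ : Rule) (σ : Subst) (good : ∀ {x} → x ∈ frontier ρ → Good (σ x)) where

    skel-good : Skel (ρ , σ) t → Good t
    skel-good (inj₁ (a , a∈ , t∈)) with concatMap⁻ {f = birthT ∘ σ} a∈
    ... | x , x∈ , a∈x = birth-good (good x∈) (a , a∈x , t∈)
    skel-good (inj₂ (x , x∈ , refl , _)) = good x∈

    birthT-skel : TermIn (birthT (σ x)) t → x ∈ frontier ρ → Skel (ρ , σ) t
    birthT-skel (a , a∈ , t∈) x∈ = inj₁ (a , concatMap⁺ {f = birthT ∘ σ} x∈ a∈ , t∈)

    skel-frontier : x ∈ frontier ρ → Skel (ρ , σ) (σ x)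
    skel-frontier {x} x∈ with σ x in eq | good x∈
    ... | const c  | _ = inj₂ (x , x∈ , eq , c , refl)
    ... | fun f ss | g = birthT-skel (subst (λ u → TermIn (birthT u) (fun f ss)) (sym eq) (birth-self g)) x∈

    skel-birth : ∀ {a} → Skel (ρ , σ) w → a ∈ birthT w → a ∈ birthTrig (ρ , σ)
    skel-birth {w = fun f ss} (inj₁ (b , b∈ , w∈)) a∈ with concatMap⁻ {f = birthT ∘ σ} b∈
    ... | x , x∈ , b∈x = concatMap⁺ {f = birthT ∘ σ} x∈ (birth-trans (good x∈) (b , b∈x , w∈) a∈)
    skel-birth {w = fun _ _} (inj₂ (_ , _ , _ , _ , ())) a∈

    skel-sk : Skel (ρ , σ) (fun (ψ , i , y) (map τ (frontier ψ))) → z ∈ headVarsAt ψ i →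
              Skel (ρ , σ) (sk ψ i τ z)
    skel-sk {ψ} {i} {y} {τ} s z∈ with skel-good s | termIn-out⁺ ψ i τ z∈
    ... | funG _ ψ∈ i≡ _ _ _ _ | a , a∈ , t∈ = inj₁ (a , skel-birth s (birth-out ψ i y τ ψ∈ i≡ a∈) , t∈)

    -- An argument whose variable occurs in the head is mentioned by the output that created the
    -- term, so it belongs to the skeleton too. The recursion runs on the goodness proof.
    skel-vis : Skel (ρ , σ) w → t ∈ vis w → Skel (ρ , σ) t
    skel-vis s t∈ = go (skel-good s) s t∈
      where
      go : Good w → Skel (ρ , σ) w → t ∈ vis w → Skel (ρ , σ) t
      go cvarG s (here refl) = s
      go {t = t} (funG {ψ} {i} {y} τ ψ∈ i≡ y∈ex y∈ refl good) s t∈ with vis⁻ ψ i y τ ψ∈ i≡ t∈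
      ... | inj₁ (z , z∈ , refl) = skel-sk s z∈
      ... | inj₂ (x , x∈ , x∈H , t∈x) =
        go (good x∈) (subst (Skel (ρ , σ)) (sk-frontier ψ∈ (hc< ψ∈ i≡) x∈) (skel-sk s x∈H)) t∈x

  GoodFacts : List Atom → Set
  GoodFacts L = ∀ {t} → TermIn L t → Good t

  goodFacts-++ : ∀ {L M} → GoodFacts L → GoodFacts M → GoodFacts (L ++ M)
  goodFacts-++ {L} gL gM (a , a∈ , t∈) with ∈-++⁻ L a∈
  ... | inj₁ a∈L = gL (a , a∈L , t∈)
  ... | inj₂ a∈M = gM (a , a∈M , t∈)

  goodFacts-loaded : ∀ {L} → GoodFacts L → Loaded (ψ , σ) ⟦ L ⟧ → x ∈ frontier ψ → Good (σ x)
  goodFacts-loaded {ψ} {σ} {L = L} gL l x∈ = gL (loaded-term {ψ = ψ} {σ} {L} l (frontier⊆body ψ x∈))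

  goodFacts-out : ∀ {L} → ψ ∈ R → GoodFacts L → Loaded (ψ , σ) ⟦ L ⟧ → GoodFacts (outhc hc (ψ , σ))
  goodFacts-out {ψ} {σ} {L} ψ∈ gL l t∈ with termIn-out⁻ ψ (hc ψ) σ t∈
  ... | z , z∈ , refl = sk-good ψ∈ refl (goodFacts-loaded {ψ} {σ} {L = L} gL l) z∈

  predOf-out : ∀ {i σ a} → ψ ∈ R → i < branching ψ → a ∈ out i (ψ , σ) →
               ∀ (k : Term → Term) → PredOf R (mapAtom k a)
  predOf-out {ψ} {i} {σ} ψ∈ i< a∈ k with ∈-map⁻ (outAtom ψ i σ) a∈
  ... | b , b∈ , refl = ψ , ψ∈ , b , ∈-++⁺ʳ (body ψ) (concatMap⁺ (disjunct∈ ψ i<) b∈) , refl ,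
    sym (trans (length-map k (map (sk ψ i σ) (args b))) (length-map (sk ψ i σ) (args b)))

  -- A partial inverse of `G` that carries labels into the fact set `O`.

  module Unblocking {ρ₁ : Rule} {σ₁ : Subst} (ρ₁∈ : ρ₁ ∈ R)
    (good₁ : ∀ {x} → x ∈ frontier ρ₁ → Good (σ₁ x))
    (G : Term → Term) (hom : Hom G) (goodG : ∀ {t} → Good t → Good (G t))
    (inj : ∀ {t u} → Skel (ρ₁ , σ₁) t → Skel (ρ₁ , σ₁) u → G t ≡ G u → t ≡ u)
    -- Stated with visible terms instead of subterms: skeletons are closed under the former, which
    -- lets the condition pass from `g` to its powers.
    (sep : ∀ {f ss c} → Skel (ρ₁ , σ₁) (fun f ss) → Skel (ρ₁ , σ₁) (const c) →
           ¬ G (fun f ss) ∈ vis (G (const c)))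
    where

    open Skeleton ρ₁ σ₁ good₁

    S : Term → Set
    S = Skel (ρ₁ , σ₁)

    μ : Trigger
    μ = ρ₁ , G ∘ σ₁

    -- A finite list that covers the skeleton and makes the searches below decidable.
    candidates : List Term
    candidates = concatMap args (birthTrig (ρ₁ , σ₁)) ++ map σ₁ (frontier ρ₁)

    skel∈ : S t → t ∈ candidates
    skel∈ (inj₁ (a , a∈ , t∈))       = ∈-++⁺ˡ (concatMap⁺ {f = args} a∈ t∈)
    skel∈ (inj₂ (x , x∈ , refl , _)) = ∈-++⁺ʳ _ (∈-map⁺ σ₁ x∈)

    opaque
      S? : ∀ t → Dec (S t)
      S? t = map′ (λ { (inj₁ t∈) → inj₁ (concatMap⁻ {f = args} t∈) ; (inj₂ p) → inj₂ (find p) })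
                  (λ { (inj₁ (a , a∈ , t∈)) → inj₁ (concatMap⁺ {f = args} a∈ t∈)
                     ; (inj₂ (x , x∈ , p)) → inj₂ (lose x∈ p) })
                  (decMembership _≟Term_ t (concatMap args (birthTrig (ρ₁ , σ₁))) ⊎-dec
                   any? (λ x → (σ₁ x ≟Term t) ×-dec isConst? t) (frontier ρ₁))

    Found : Term → Set
    Found t = Σ Term λ u → S u × G u ≡ t

    opaque
      found? : ∀ t → Dec (Found t)
      found? t = map′ (λ p → let u , _ , q = find p in u , q) (λ { (u , s , eq) → lose (skel∈ s) (s , eq) })
                      (any? (λ u → S? u ×-dec (G u ≟Term t)) candidates)

    -- These terms are sent to constants, so that facts made of them are already base facts of `O`.
    BelowConst : Term → Set
    BelowConst t = Σ Term λ u → S u × IsConst u × t ∈ vis (G u)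

    opaque
      belowConst? : ∀ t → Dec (BelowConst t)
      belowConst? t = map′ (λ p → let u , _ , q = find p in u , q) (λ { (u , s , p) → lose (skel∈ s) (s , p) })
        (any? (λ u → S? u ×-dec isConst? u ×-dec decMembership _≟Term_ t (vis (G u))) candidates)

    -- The graph of the partial inverse. Unmatched functional terms go to `cfun f` because h_uc
    -- treats new functional terms in the same way, so `k` commutes with derivations in `O`; terms
    -- inside images of constants go to `star` so that base facts cover them.
    data K : Term → Term → Set where
      found  : S u → G u ≡ t → K t u
      toStar : ¬ Found t → BelowConst t ⊎ IsConst t → K t (const star)
      toFun  : ∀ {f ss} → ¬ Found (fun f ss) → ¬ BelowConst (fun f ss) → K (fun f ss) (const (cfun f))

    opaque
      K-total : ∀ t → Σ Term (K t)
      K-total t with found? t | belowConst? t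
      K-total t          | yes (u , s , eq) | _      = u , found s eq
      K-total t          | no ¬f            | yes b  = const star , toStar ¬f (inj₁ b)
      K-total (const c)  | no ¬f            | no _   = const star , toStar ¬f (inj₂ (c , refl))
      K-total (fun f ss) | no ¬f            | no ¬b  = const (cfun f) , toFun ¬f ¬b

    k : Term → Term
    k t = proj₁ (K-total t)

    -- The fallback values `star` and `cfun f` are not `Good`, so a good value certifies that a
    -- preimage was found.
    k-good : Good (k t) → S (k t) × G (k t) ≡ t
    k-good {t} g with K-total t
    k-good g  | _ , found s eq = s , eq
    k-good () | _ , toStar _ _
    k-good () | _ , toFun _ _

    fun∉belowConst : ∀ {f ss} → S (fun f ss) → ¬ BelowConst (G (fun f ss))
    fun∉belowConst s (_ , sc , (_ , refl) , t∈) = sep s sc t∈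

    fun≢const : ∀ {f ss} → ¬ IsConst (G (fun f ss))
    fun≢const {f} {ss} (c , eq) with trans (sym (hom f ss)) eq
    ... | ()

    k-const : BelowConst t ⊎ IsConst t → Σ Const λ c → k t ≡ const c × (S (k t) ⊎ c ≡ star)
    k-const {t} b with K-total t
    k-const b        | const c , found s eq        = c , refl , inj₁ s
    k-const (inj₁ b) | fun _ _ , found s refl      = contradiction b (fun∉belowConst s)
    k-const (inj₂ b) | fun _ _ , found s refl      = contradiction b fun≢const
    k-const b        | _       , toStar _ _        = star , refl , inj₂ refl
    k-const (inj₁ b) | _       , toFun ¬f ¬b       = contradiction b ¬b
    k-const (inj₂ (_ , ())) | _ , toFun ¬f ¬b

    -- Injectivity of `G` on the skeleton forces the preimage that the search returns to be `u`.
    k-G : S u → k (G u) ≡ u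
    k-G {u} s with K-total (G u)
    ... | _ , view = go view refl
      where
      go : ∀ {t r} → K t r → G u ≡ t → r ≡ u
      go (found sr eq) eq' = inj sr s (trans eq (sym eq'))
      go (toStar ¬f _) eq' = contradiction (u , s , eq') ¬f
      go (toFun ¬f _)  eq' = contradiction (u , s , eq') ¬f

    k-fun : ∀ {f ss} → ¬ Found (fun f ss) → ¬ BelowConst (fun f ss) → k (fun f ss) ≡ const (cfun f)
    k-fun {f} {ss} ¬f ¬b with K-total (fun f ss)
    ... | u , found s eq                  = contradiction (u , s , eq) ¬f
    ... | _ , toStar _ (inj₁ b)           = contradiction b ¬b
    ... | _ , toStar _ (inj₂ (_ , ()))
    ... | _ , toFun _ _                   = refl

    -- The values that `IsHuc` prescribes outside the skeleton. An explicit h_uc is needed because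
    -- uc-unblockability quantifies over all maps satisfying `IsHuc`.
    h-away : Term → Term
    h-away (fun f _)        = const (cfun f)
    h-away (const (cfun f)) = const (cfun f)
    h-away (const _)        = const star

    h : Term → Term
    h t = if does (S? t) then t else h-away t

    h-skel : S t → h t ≡ t
    h-skel {t} s = cong (λ b → if b then t else h-away t) (dec-true (S? t) s)

    h-¬skel : ¬ S t → h t ≡ h-away t
    h-¬skel {t} s = cong (λ b → if b then t else h-away t) (dec-false (S? t) s)

    h-fixed : h-away t ≡ t → h t ≡ t
    h-fixed {t} eq = go (does (S? t))
      where
      go : ∀ b → (if b then t else h-away t) ≡ t
      go true  = refl
      go false = eq

    isHuc : IsHuc (ρ₁ , σ₁) h
    isHuc t = h-skel , (λ { f ts refl → h-¬skel }) , (λ { f refl → h-fixed refl }) , away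
      where
      away : ∀ c → t ≡ const c → ¬ S t → (∀ f → ¬ (c ≡ cfun f)) → h t ≡ const star
      away (con _)  refl ¬s _  = h-¬skel ¬s
      away (cvar _) refl ¬s _  = h-¬skel ¬s
      away (cfun f) refl ¬s ¬c = contradiction refl (¬c f)
      away star     refl ¬s _  = h-¬skel ¬s

    h-k : ∀ t → h (k t) ≡ k t
    h-k t with K-total t
    ... | _ , found s _  = h-skel s
    ... | _ , toFun _ _  = h-fixed refl
    ... | _ , toStar _ _ = h-fixed refl

    Oλ : FactSet
    Oλ = O R hc (ρ₁ , σ₁) h

    k-base : ∀ {a} → PredOf R (mapAtom k a) → (∀ {t} → t ∈ args a → BelowConst t ⊎ IsConst t) → Oλ (mapAtom k a)
    k-base {a} p consts = base p arg
      where
      arg : ∀ {t} → t ∈ args (mapAtom k a) → Σ Const λ c → t ≡ const c × (S t ⊎ c ≡ star)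
      arg t∈ with ∈-map⁻ k t∈
      ... | u , u∈ , refl = k-const (consts u∈)

    termOver-k : Good t → TermOver R (k t)
    termOver-k {t} _ with K-total t
    ... | _ , found s _  = good-termOver (skel-good s)
    ... | _ , toStar _ _ = tconst _
    ... | _ , toFun _ _  = tconst _

    mapAtom-inverse : ∀ a → (∀ {t} → t ∈ args a → S t) → mapAtom k (mapAtom G a) ≡ a
    mapAtom-inverse (atom p ts) ss = cong (atom p)
      (trans (sym (map-∘ ts)) (trans (map-cong-∈ ts λ t∈ → k-G (ss t∈)) (map-id ts)))

    Out⊆ : List Atom → Set
    Out⊆ L = ∀ {a} → a ∈ outhc hc μ → a ∈ L

    -- A single chase step on the branch. The output of `μ` has to be missing even after the step,
    -- since `derived` excludes triggers with the output of `(ρ₁ , σ₁)`.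
    module Step {L : List Atom} (goodL : GoodFacts L) (kL : ∀ {a} → a ∈ L → Oλ (mapAtom k a))
      {ψ : Rule} {σ : Subst} (ψ∈ : ψ ∈ R) (l : Loaded (ψ , σ) ⟦ L ⟧)
      (¬out : ¬ Out⊆ (L ++ outhc hc (ψ , σ))) where

      new : Var → Term
      new y = fun (ψ , hc ψ , y) (map σ (frontier ψ))

      goodσ : ∀ {x} → x ∈ bodyVars ψ → Good (σ x)
      goodσ x∈ = goodL (loaded-term {ψ = ψ} {σ} {L} l x∈)

      Old : Var → Set
      Old y = y ∈ exVarsAt ψ (hc ψ) × (Found (new y) ⊎ BelowConst (new y))

      old? : ∀ y → Dec (Old y)
      old? y = (y ∈v? exVarsAt ψ (hc ψ)) ×-dec (found? (new y) ⊎-dec belowConst? (new y))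

      -- All terms of the output are visible in `new y`. Once `new y` is visible in the image of a
      -- constant, so are all of them, and the mapped facts are base facts.
      below : ∀ {y a} → BelowConst (new y) → a ∈ outhc hc (ψ , σ) → Oλ (mapAtom k a)
      below {y} {a} (u , s , c , new∈) a∈ = k-base (predOf-out {i = hc ψ} {σ} ψ∈ (hch ψ∈) a∈ k) arg
        where
        arg : ∀ {t} → t ∈ args a → BelowConst t ⊎ IsConst t
        arg t∈ with termIn-out⁻ ψ (hc ψ) σ (a , a∈ , t∈)
        ... | z , z∈ , refl = inj₁ (u , s , c , vis-trans (goodG (skel-good s)) new∈
                (vis⁺ ψ (hc ψ) y σ ψ∈ refl (inj₁ (z , z∈ , refl))))

      -- `G` keeps function symbols, so the skeleton term was created by the same rule and disjunct.
      -- The output of the step is then the `G`-image of birth facts of `(ρ₁ , σ₁)`, and `k` undoes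
      -- `G` on them.
      fromBirth : ∀ {y f ss a} → S (fun f ss) → Good (fun f ss) → G (fun f ss) ≡ new y →
                  a ∈ outhc hc (ψ , σ) → Oλ (mapAtom k a)
      fromBirth {a = a} s (funG {ψ'} {i} {y'} τ _ _ _ _ refl _) eq a∈
        with trans (sym (hom _ _)) eq
      ... | eq' = go a∈ (fun-injˡ eq') (fun-injʳ eq')
        where
        go : ∀ {y} → a ∈ outhc hc (ψ , σ) → (ψ' , i , y') ≡ (ψ , hc ψ , y) →
             map G (map τ (frontier ψ')) ≡ map σ (frontier ψ) → Oλ (mapAtom k a)
        go a∈ refl args≡ with ∈-map⁻ (mapAtom G) (subst (a ∈_)
             (trans (out-cong ψ∈ (hch ψ∈) λ x∈ →
                       sym (map-≡-∈ (frontier ψ) (trans (map-∘ (frontier ψ)) args≡) x∈))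
                    (sym (out-hom hom ψ (hc ψ) τ))) a∈)
        ... | a₀ , a₀∈ , refl =
          subst Oλ (sym (mapAtom-inverse a₀ λ t∈ → inj₁ (a₀ , a₀∈birth , t∈))) (born a₀∈birth)
          where
          a₀∈birth : a₀ ∈ birthTrig (ρ₁ , σ₁)
          a₀∈birth = skel-birth s (birth-out ψ (hc ψ) y' τ ψ∈ refl a₀∈)

      -- The step is imitated by the trigger `(ψ , k ∘ σ)`: `differs` is the side condition of
      -- `derived`, and `same` identifies the facts obtained.
      fromTrigger : ∀ {a} → (∀ {y} → y ∈ headVarsAt ψ (hc ψ) → ¬ Old y) → a ∈ outhc hc (ψ , σ) →
                    Oλ (mapAtom k a)
      fromTrigger {a} ¬old a∈ =
        derived (ψ∈ , λ x∈ → termOver-k (goodσ x∈)) (loaded-map {ψ} {σ} {⟦ L ⟧} {Oλ} k kL l) differs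
          (subst (mapAtom k a ∈_) same (∈-map⁺ (mapAtom k) a∈))
        where
        -- Goodness rules out fallback constants among the values of `k`, so `G` restores the
        -- original terms.
        sk-G : ∀ {z} → z ∈ headVarsAt ψ (hc ψ) → Good (sk ψ (hc ψ) (k ∘ σ) z) →
               G (sk ψ (hc ψ) (k ∘ σ) z) ≡ sk ψ (hc ψ) σ z
        sk-G {z} z∈ with head-cases ψ∈ (hch ψ∈) z∈
        ... | inj₁ z∈ex rewrite sk-ex ψ (hc ψ) (k ∘ σ) z∈ex | sk-ex ψ (hc ψ) σ z∈ex = λ g →
          trans (hom _ _) (cong (fun _) (trans (sym (map-∘ (frontier ψ)))
            (map-cong-∈ (frontier ψ) λ x∈ → proj₂ (k-good (good-args g x∈)))))
        ... | inj₂ (z∉ex , _) rewrite sk-fr ψ (hc ψ) (k ∘ σ) z∉ex | sk-fr ψ (hc ψ) σ z∉ex =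
          λ g → proj₂ (k-good g)

        -- If the outputs agreed, every term of the imitated output would occur in the output of
        -- `(ρ₁ , σ₁)` and hence be good. Then `G` would turn it into the real output of the step,
        -- which would contain that of `μ`.
        differs : ¬ SetEq (outhc hc (ψ , k ∘ σ)) (outhc hc (ρ₁ , σ₁))
        differs eq = ¬out λ {b} b∈ → ∈-++⁺ʳ L
          (subst (b ∈_) (map-out-cong ψ (hc ψ) λ z∈ → sk-G z∈ (clean z∈)) (G-image b∈))
          where
          clean : ∀ {z} → z ∈ headVarsAt ψ (hc ψ) → Good (sk ψ (hc ψ) (k ∘ σ) z)
          clean z∈ with termIn-out⁺ ψ (hc ψ) (k ∘ σ) z∈
          ... | b , b∈ , t∈ with termIn-out⁻ ρ₁ (hc ρ₁) σ₁ (b , proj₁ (eq b) b∈ , t∈)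
          ...   | z' , z'∈ , eq' = subst Good (sym eq') (sk-good ρ₁∈ refl good₁ z'∈)

          G-image : ∀ {b} → b ∈ outhc hc μ → b ∈ map (mapAtom G) (outhc hc (ψ , k ∘ σ))
          G-image {b} b∈ with ∈-map⁻ (mapAtom G) (subst (b ∈_) (sym (out-hom hom ρ₁ (hc ρ₁) σ₁)) b∈)
          ... | b₀ , b₀∈ , refl = ∈-map⁺ (mapAtom G) (proj₂ (eq b₀) b₀∈)

        sk-k : ∀ {z} → z ∈ headVarsAt ψ (hc ψ) → k (sk ψ (hc ψ) σ z) ≡ h (sk ψ (hc ψ) (k ∘ σ) z)
        sk-k {z} z∈ with head-cases ψ∈ (hch ψ∈) z∈
        ... | inj₂ (z∉ex , _) rewrite sk-fr ψ (hc ψ) (k ∘ σ) z∉ex | sk-fr ψ (hc ψ) σ z∉ex = sym (h-k (σ z))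
        ... | inj₁ z∈ex = trans (cong k (sk-ex ψ (hc ψ) σ z∈ex))
          (trans (k-fun (λ f → ¬old z∈ (z∈ex , inj₁ f)) (λ b → ¬old z∈ (z∈ex , inj₂ b)))
            (sym (trans (cong h (sk-ex ψ (hc ψ) (k ∘ σ) z∈ex)) (h-¬skel not-skel))))
          where
          -- A skeleton term here would be a preimage of `new z`, making `z` an `Old` variable.
          not-skel : ¬ S (fun (ψ , hc ψ , z) (map (k ∘ σ) (frontier ψ)))
          not-skel s = ¬old z∈ (z∈ex , inj₁ (_ , s ,
            trans (cong G (sym (sk-ex ψ (hc ψ) (k ∘ σ) z∈ex)))
              (trans (sk-G z∈ (subst Good (sym (sk-ex ψ (hc ψ) (k ∘ σ) z∈ex)) (skel-good s)))
                (sk-ex ψ (hc ψ) σ z∈ex))))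

        same : map (mapAtom k) (outhc hc (ψ , σ)) ≡ map (mapAtom h) (outhc hc (ψ , k ∘ σ))
        same = trans (sym (map-∘ (proj₂ (disjunct ψ (hc ψ)))))
          (trans (map-cong-∈ (proj₂ (disjunct ψ (hc ψ))) λ {b} b∈ →
            cong (atom (pred b)) (trans (sym (map-∘ (args b)))
              (trans (map-cong-∈ (args b) λ z∈ → sk-k (concatMap⁺ b∈ z∈)) (map-∘ (args b)))))
            (map-∘ (proj₂ (disjunct ψ (hc ψ)))))

      step : ∀ {a} → a ∈ outhc hc (ψ , σ) → Oλ (mapAtom k a)
      step a∈ with any? old? (headVarsAt ψ (hc ψ))
      ... | no ¬old = fromTrigger (λ y∈ old → ¬old (lose y∈ old)) a∈
      ... | yes p with find p
      ...   | y , y∈ , _ , inj₂ b = below b a∈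
      -- `G` may send a skeleton constant to the new functional term itself, which is visible in
      -- itself.
      ...   | y , y∈ , _ , inj₁ (const c , s , eq) =
        below (const c , s , (c , refl) , subst (_∈ vis (G (const c))) eq
          (vis-self (goodG (skel-good s)))) a∈
      ...   | y , y∈ , _ , inj₁ (fun f ss , s , eq) = fromBirth s (skel-good s) eq a∈

    obsolete-k : ∀ {L} → (∀ {a} → a ∈ L → Oλ (mapAtom k a)) → Obsolete μ ⟦ L ⟧ → Obsolete (ρ₁ , σ₁) Oλ
    obsolete-k {L} kL (σ' , ext , i , i< , inL) = σ'' , ext'' , i , i< , inO
      where
      σ'' : Subst
      -- On body variables `σ₁` is taken directly: `k` is known to invert `G` only on the skeleton,
      -- which need not contain the values of variables outside the frontier.
      σ'' x = if does (x ∈v? bodyVars ρ₁) then σ₁ x else k (σ' x)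

      ext'' : ∀ {x} → x ∈ bodyVars ρ₁ → σ'' x ≡ σ₁ x
      ext'' {x} x∈ = cong (λ b → if b then σ₁ x else k (σ' x)) (dec-true (x ∈v? bodyVars ρ₁) x∈)

      agree : ∀ {x} → x ∈ headVarsAt ρ₁ i → σ'' x ≡ k (σ' x)
      agree {x} x∈ with x ∈v? bodyVars ρ₁
      ... | no _   = refl
      ... | yes x∈b =
        sym (trans (cong k (ext x∈b)) (k-G (skel-frontier (body∩head⊆frontier ρ₁ i< x∈b x∈))))

      inO : ∀ {a} → a ∈ map (substAtom σ'') (proj₂ (disjunct ρ₁ i)) → Oλ a
      inO a∈ with ∈-map⁻ (substAtom σ'') a∈
      ... | b , b∈ , refl = subst Oλ (cong (atom (pred b))
              (trans (sym (map-∘ (args b))) (sym (map-cong-∈ (args b) λ x∈ → agree (concatMap⁺ b∈ x∈)))))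
              (kL (inL (∈-map⁺ (substAtom σ') b∈)))

    -- `O` contains all facts over skeleton constants and `star`, so mapping the existential
    -- variables to `star` satisfies the head.
    const-obsolete : (∀ {x} → x ∈ frontier ρ₁ → IsConst (σ₁ x)) → Obsolete (ρ₁ , σ₁) Oλ
    const-obsolete consts = σ'' , ext'' , hc ρ₁ , hch ρ₁∈ , inO
      where
      σ'' : Subst
      σ'' x = if does (x ∈v? bodyVars ρ₁) then σ₁ x else const star

      ext'' : ∀ {x} → x ∈ bodyVars ρ₁ → σ'' x ≡ σ₁ x
      ext'' {x} x∈ = cong (λ b → if b then σ₁ x else const star) (dec-true (x ∈v? bodyVars ρ₁) x∈)

      arg : ∀ {x} → x ∈ headVarsAt ρ₁ (hc ρ₁) → Σ Const λ c → σ'' x ≡ const c × (S (σ'' x) ⊎ c ≡ star)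
      arg {x} x∈ with x ∈v? bodyVars ρ₁
      ... | no _    = star , refl , inj₂ refl
      ... | yes x∈b =
        let x∈fr = body∩head⊆frontier ρ₁ (hch ρ₁∈) x∈b x∈
            c , eq = consts x∈fr
        in c , eq , inj₁ (skel-frontier x∈fr)

      inO : ∀ {a} → a ∈ map (substAtom σ'') (proj₂ (disjunct ρ₁ (hc ρ₁))) → Oλ a
      inO a∈ with ∈-map⁻ (substAtom σ'') a∈
      ... | b , b∈ , refl =
        base (ρ₁ , ρ₁∈ , b , ∈-++⁺ʳ (body ρ₁) (concatMap⁺ (disjunct∈ ρ₁ (hch ρ₁∈)) b∈) , refl ,
              sym (length-map σ'' (args b))) args-const
        where
        args-const : ∀ {t} → t ∈ map σ'' (args b) → Σ Const λ c → t ≡ const c × (S t ⊎ c ≡ star)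
        args-const t∈ with ∈-map⁻ σ'' t∈
        ... | x , x∈ , refl = arg (concatMap⁺ b∈ x∈)

  functional-frontier : (∀ {x} → x ∈ frontier ψ → Good (σ x)) → ψ ∈ R → UCUnblockable R hc (ψ , σ) →
                        ¬ Datalog ψ → Σ Var λ x → x ∈ frontier ψ × ¬ IsConst (σ x)
  functional-frontier good ψ∈ (inj₁ dl) ¬dl = contradiction dl ¬dl
  functional-frontier {ψ} {σ} good ψ∈ (inj₂ uc) _ with any? (λ x → ¬? (isConst? (σ x))) (frontier ψ)
  ... | yes p = find p
  ... | no ¬p = contradiction
    (const-obsolete λ {x} x∈ → decidable-stable (isConst? (σ x)) λ ¬c → ¬p (lose x∈ ¬c)) (uc h isHuc)
    where
    id-hom : Hom id
    id-hom f ts = cong (fun f) (sym (map-id ts))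

    id-inj : ∀ {t u} → Skel (ψ , σ) t → Skel (ψ , σ) u → t ≡ u → t ≡ u
    id-inj _ _ eq = eq

    id-sep : ∀ {f ss c} → Skel (ψ , σ) (fun f ss) → Skel (ψ , σ) (const c) → ¬ fun f ss ∈ vis (const c)
    id-sep _ _ (here ())

    -- Only `h`, `isHuc` and `const-obsolete` are wanted, so the identity serves as `G`.
    open Unblocking {σ₁ = σ} ψ∈ good id id-hom id id-inj id-sep

  -- Without existential variables and with a single disjunct, any extension witnessing obsoleteness
  -- produces the output itself.
  datalog-out : ∀ {F : FactSet} {a} → ψ ∈ R → Datalog ψ → Obsolete (ψ , σ) F → a ∈ outhc hc (ψ , σ) → F a
  datalog-out {ψ} {σ} {F} ψ∈ (one , noEx) (σ' , ext , i , i< , inF) a∈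
    with hc ψ | n<1⇒n≡0 (subst (hc ψ <_) one (hch ψ∈)) | n<1⇒n≡0 (subst (i <_) one i<)
  ... | .0 | refl | refl with ∈-map⁻ (outAtom ψ 0 σ) a∈
  ...   | b , b∈ , refl =
    subst F (cong (atom (pred b)) (map-cong-∈ (args b) same)) (inF (∈-map⁺ (substAtom σ') b∈))
    where
    same : ∀ {x} → x ∈ args b → σ' x ≡ sk ψ 0 σ x
    same {x} x∈ = sk-elim (σ' x ≡_) ψ∈ i< (concatMap⁺ b∈ x∈)
      (λ x∈ex → ⊥-elim (¬∈[] (subst (x ∈_) noEx x∈ex)))
      (λ x∈fr → ext (frontier⊆body ψ x∈fr))
      where
      ¬∈[] : ¬ x ∈ []
      ¬∈[] ()

  rule-database-args : ∀ ρ → TermIn (Dρ ρ) t → Σ Var λ x → t ≡ const (cvar x)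
  rule-database-args ρ (a , a∈ , t∈) with ∈-map⁻ (substAtom σuc) a∈
  ... | b , b∈ , refl with ∈-map⁻ σuc t∈
  ...   | x , x∈ , refl = x , refl

  goodFacts-rule-database : ∀ ρ → GoodFacts (Dρ ρ)
  goodFacts-rule-database ρ t∈ with rule-database-args ρ t∈
  ... | x , refl = cvarG

  predOf-rule-database : ∀ {ρ a} → ρ ∈ R → a ∈ Dρ ρ → ∀ (k : Term → Term) → PredOf R (mapAtom k a)
  predOf-rule-database {ρ} ρ∈ a∈ k with ∈-map⁻ (substAtom σuc) a∈
  ... | b , b∈ , refl = ρ , ρ∈ , b , ∈-++⁺ˡ b∈ , refl ,
    sym (trans (length-map k (map σuc (args b))) (length-map σuc (args b)))

-- The branch of a chase tree that follows the head-choice.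

module Branch {R : List Rule} {hc : Rule → ℕ} (wf : ∀ {ψ} → ψ ∈ R → WFRule ψ) (hch : HeadChoice R hc)
  {ρ : Rule} (ρ∈ : ρ ∈ R) {T : Tree} (ct : ChaseTree R (Dρ ρ) T) where

  open Chase wf hch
  open ChaseTree ct

  L : List ℕ → List Atom
  L = label (Dρ ρ) T

  label-step : ∀ {v ψ σ} → trig T v ≡ just (ψ , σ) → L (hc ψ ∷ v) ≡ L v ++ outhc hc (ψ , σ)
  label-step {v} {ψ} eq = cong (λ m → L v ++ outM (hc ψ) m) eq

  label-step⁺ : ∀ {v ψ σ a} → trig T v ≡ just (ψ , σ) → a ∈ L v ++ outhc hc (ψ , σ) → a ∈ L (hc ψ ∷ v)
  label-step⁺ {a = a} eq = subst (a ∈_) (sym (label-step eq))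

  vertex : ∀ {v} → OnBranch hc T v → Vertex T v
  vertex broot = root
  vertex (bstep b eq) with inner (vertex b) eq
  ... | (ψ∈ , _) , _ , _ , _ , children = proj₂ (children _) (hch ψ∈)

  label-good : ∀ {v} → OnBranch hc T v → GoodFacts (L v)
  label-good broot = goodFacts-rule-database ρ
  label-good (bstep {v} {ψ} {σ} b eq) with inner (vertex b) eq
  ... | (ψ∈ , _) , l , _ = subst GoodFacts (sym (label-step eq))
    (goodFacts-++ (label-good b) (goodFacts-out {ψ} {σ} {L = L v} ψ∈ (label-good b) l))

  module _ {ρ₁ : Rule} {σ₁ : Subst} (ρ₁∈ : ρ₁ ∈ R)
    (good₁ : ∀ {x} → x ∈ frontier ρ₁ → Good (σ₁ x))
    (G : Term → Term) (hom : Hom G) (goodG : ∀ {t} → Good t → Good (G t))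
    (inj : ∀ {t u} → Skel (ρ₁ , σ₁) t → Skel (ρ₁ , σ₁) u → G t ≡ G u → t ≡ u)
    (sep : ∀ {f ss c} → Skel (ρ₁ , σ₁) (fun f ss) → Skel (ρ₁ , σ₁) (const c) →
           ¬ G (fun f ss) ∈ vis (G (const c)))
    where

    open Unblocking {σ₁ = σ₁} ρ₁∈ good₁ G hom goodG inj sep

    -- Labels only grow along the branch, so an output missing at `v` was missing at every earlier
    -- vertex, as `Step` requires.
    label-k : ∀ {v} → OnBranch hc T v → ¬ Out⊆ (L v) → ∀ {a} → a ∈ L v → Oλ (mapAtom k a)
    label-k broot ¬out a∈ = k-base (predOf-rule-database ρ∈ a∈ k) λ t∈ →
      let x , eq = rule-database-args ρ (_ , a∈ , t∈) in inj₂ (cvar x , eq)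
    label-k (bstep {v} {ψ} {σ} b eq) ¬out {a} a∈ with inner (vertex b) eq
    ... | (ψ∈ , _) , l , _ with ∈-++⁻ (L v) (subst (a ∈_) (label-step eq) a∈)
    ...   | inj₁ a∈v   = label-k b (λ out⊆ → ¬out λ b∈ → label-step⁺ eq (∈-++⁺ˡ (out⊆ b∈))) a∈v
    ...   | inj₂ a∈new = Step.step {L v} (label-good b)
      (label-k b (λ out⊆ → ¬out λ b∈ → label-step⁺ eq (∈-++⁺ˡ (out⊆ b∈))))
      {ψ} {σ} ψ∈ l (λ out⊆ → ¬out λ b∈ → label-step⁺ eq (out⊆ b∈)) a∈new

    obsolete⇒out : UCUnblockable R hc (ρ₁ , σ₁) → ∀ {v} → OnBranch hc T v →
                   Obsolete (ρ₁ , G ∘ σ₁) ⟦ L v ⟧ → ∀ {a} → a ∈ outhc hc (ρ₁ , G ∘ σ₁) → a ∈ L v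
    obsolete⇒out (inj₁ dl) {v} b obs a∈ = datalog-out {σ = G ∘ σ₁} {⟦ L v ⟧} ρ₁∈ dl obs a∈
    obsolete⇒out (inj₂ uc) {v} b obs a∈ = All.lookup all a∈
      where
      all : All.All (_∈ L v) (outhc hc μ)
      -- Membership in a finite label is decidable, so the output may be assumed missing; then
      -- obsoleteness transfers to `O`, against uc-unblockability.
      all = decidable-stable (All.all? (_∈atoms? L v) (outhc hc μ)) λ ¬all →
        uc h isHuc (obsolete-k {L v} (label-k b λ out⊆ → ¬all (All.tabulate out⊆)) obs)

  data Extends (w : List ℕ) : List ℕ → Set where
    same : Extends w w
    more : ∀ {v i} → Extends w v → Extends w (i ∷ v)

  extends-label : ∀ {w v a} → Extends w v → a ∈ L w → a ∈ L v
  extends-label same     a∈ = a∈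
  extends-label (more e) a∈ = ∈-++⁺ˡ (extends-label e a∈)

  extends-step : ∀ {w v ψ σ} → trig T w ≡ just (ψ , σ) → OnBranch hc T v → Extends w v →
                 w ≡ v ⊎ Extends (hc ψ ∷ w) v
  extends-step eq b same = inj₁ refl
  extends-step eq (bstep b eq') (more e) with extends-step eq b e
  ... | inj₂ e' = inj₂ (more e')
  ... | inj₁ refl with trans (sym eq) eq'
  ...   | refl = inj₂ same

  -- Each vertex carries one trigger, so the head-choice determines a linear branch and a leaf on it
  -- lies beyond all its other vertices.
  leaf-extends : ∀ {v w} → OnBranch hc T v → trig T v ≡ nothing → OnBranch hc T w → Extends w v
  leaf-extends broot       stop broot = same
  leaf-extends (bstep b e) stop broot = more (root-extends b)
    where
    root-extends : ∀ {v} → OnBranch hc T v → Extends [] v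
    root-extends broot       = same
    root-extends (bstep b _) = more (root-extends b)
  leaf-extends b stop (bstep b' eq) with extends-step eq b (leaf-extends b stop b')
  ... | inj₂ e = e
  ... | inj₁ refl with trans (sym stop) eq
  ...   | ()

  module Infinite (noLeaf : ∀ {v} → OnBranch hc T v → ¬ trig T v ≡ nothing) where

    next : ∀ {v} → OnBranch hc T v → Σ Trigger λ tr → trig T v ≡ just tr
    next {v} b with trig T v in eq
    ... | just tr = tr , refl
    ... | nothing = contradiction eq (noLeaf b)

    path : ℕ → Σ (List ℕ) (OnBranch hc T)
    path zero    = [] , broot
    path (suc n) = let v , b = path n
                       (ψ , σ) , eq = next b
                   in hc ψ ∷ v , bstep b eq

    path-length : ∀ n → length (proj₁ (path n)) ≡ n
    path-length zero    = refl
    path-length (suc n) = cong suc (path-length n)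

    -- Locates a vertex of the branch on the enumerated path, so that fairness can be invoked from
    -- that vertex on.
    path-complete : ∀ {v} → OnBranch hc T v → proj₁ (path (length v)) ≡ v
    path-complete broot = refl
    path-complete (bstep {v} b eq) with path (length v) | path-complete b
    ... | .v , b' | refl with next b'
    ...   | tr , eq' with trans (sym eq) eq'
    ...     | refl = refl

    fair-path : ∀ {v tr} → OnBranch hc T v → RTrigger R tr → Loaded tr ⟦ L v ⟧ →
                Σ (List ℕ) λ w → OnBranch hc T w × Obsolete tr ⟦ L w ⟧
    fair-path {v} {tr} b rt l
      with fair (proj₁ ∘ path) refl (λ n → _ , refl) (vertex ∘ proj₂ ∘ path) tr rt (length v)
           (λ {a} → subst (λ u → Loaded tr ⟦ L u ⟧) (sym (path-complete b)) (λ {a} → l {a}) {a})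
    ... | m , _ , obs = proj₁ (path m) , proj₂ (path m) , obs

    ¬finite : ¬ FiniteTree T
    ¬finite (vs , all∈) =
      1+n≰n (subst (_≤ bound vs) (path-length N) (longest vs (all∈ (vertex (proj₂ (path N))))))
      where
      bound : List (List ℕ) → ℕ
      bound []       = 0
      bound (v ∷ vs) = length v ⊔ bound vs

      longest : ∀ vs {v} → v ∈ vs → length v ≤ bound vs
      longest (v ∷ vs) (here refl) = m≤m⊔n _ _
      longest (v ∷ vs) (there v∈)  = ≤-trans (longest vs v∈) (m≤n⊔m (length v) _)

      N : ℕ
      N = suc (bound vs)

-- Term depth and indexing of trigger lists.

mutual
  depth : Term → ℕ
  depth (const _)  = 0
  depth (fun _ ts) = suc (depths ts)

  depths : List Term → ℕ
  depths []       = 0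
  depths (t ∷ ts) = depth t ⊔ depths ts

depth≤depths : ∀ {ts} → t ∈ ts → depth t ≤ depths ts
depth≤depths {ts = t ∷ ts} (here refl) = m≤m⊔n (depth t) (depths ts)
depth≤depths {ts = s ∷ ts} (there t∈)  = ≤-trans (depth≤depths t∈) (m≤n⊔m (depth s) (depths ts))

⊑-depth : t ⊑ u → depth t ≤ depth u
⊑-depth here          = ≤-refl
⊑-depth (under t⊑ u∈) = m≤n⇒m≤1+n (≤-trans (⊑-depth t⊑) (depth≤depths u∈))

⊑-hom : ∀ {G} → Hom G → t ⊑ u → G t ⊑ G u
⊑-hom hom here                         = here
⊑-hom {t} {G = G} hom (under {f = f} {ts} t⊑ u∈) =
  subst (G t ⊑_) (sym (hom f ts)) (under (⊑-hom hom t⊑) (∈-map⁺ G u∈))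

nthD∈∷ʳ : ∀ (e : A) ms k → nthD e ms k ∈ ms ∷ʳ e
nthD∈∷ʳ e []       k       = here refl
nthD∈∷ʳ e (m ∷ ms) zero    = here refl
nthD∈∷ʳ e (m ∷ ms) (suc k) = there (nthD∈∷ʳ e ms k)

nthD-length : ∀ (e : A) ms → nthD e ms (length ms) ≡ e
nthD-length e []       = refl
nthD-length e (m ∷ ms) = nthD-length e ms

-- `LoadedList` consumes triggers at the front, whereas `Fseq` appends outputs at the back; this
-- reconciles the two.
Fseq-shift : ∀ F hc Λ k → Fseq (F ++ outhc hc (Λ 0)) hc (Λ ∘ suc) k ≡ Fseq F hc Λ (suc k)
Fseq-shift F hc Λ zero    = refl
Fseq-shift F hc Λ (suc k) = cong (_++ outhc hc (Λ (suc k))) (Fseq-shift F hc Λ k)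

loadedList-nth : ∀ {hc F} ms e → LoadedList hc F (ms ∷ʳ e) → ∀ {k} → k ≤ length ms →
                 Loaded (nthD e ms k) ⟦ Fseq F hc (nthD e ms) k ⟧
loadedList-nth []       e (l , _)  {zero}  _       = l
loadedList-nth (m ∷ ms) e (l , _)  {zero}  _       = l
loadedList-nth {hc} {F} (m ∷ ms) e (_ , ls) {suc k} (s≤s k≤) =
  loaded-mono {nthD e ms k} (λ {a} → subst (a ∈_) (Fseq-shift F hc (nthD e (m ∷ ms)) k))
    (loadedList-nth ms e ls k≤)

-- The infinite sequence: loadedness and growth.

module Prefix {R : List Rule} {hc : Rule → ℕ} (wf : ∀ {ψ} → ψ ∈ R → WFRule ψ) (hch : HeadChoice R hc)
  {ρ : Rule} (ρ∈ : ρ ∈ R) (mid : List Trigger) (σn : Subst)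
  (rt : ∀ {tr} → tr ∈ ((ρ , σuc) ∷ (mid ∷ʳ (ρ , σn))) → RTrigger R tr)
  (ll : LoadedList hc (Dρ ρ) ((ρ , σuc) ∷ (mid ∷ʳ (ρ , σn))))
  (uc : ∀ {tr} → tr ∈ (mid ∷ʳ (ρ , σn)) → UCUnblockable R hc tr)
  (gu : GUnblockable R (Dρ ρ) hc (ρ , σuc))
  (cyclic : Σ Atom λ a → a ∈ outhc hc (ρ , σn) × Σ Term λ t → t ∈ args a × Cyclic ρ t)
  (rev : ∀ {tr} → tr ∈ (mid ∷ʳ (ρ , σn)) → ∀ j →
         Reversible (gΛ ρ σn) (Skel (proj₁ tr , λ x → iterC j (gΛ ρ σn) (proj₂ tr x)))) where

  open Chase wf hch

  g : CMap
  g = gΛ ρ σn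

  g^ : ℕ → Term → Term
  g^ j = iterC j g

  len n : ℕ
  len = length mid
  n   = suc len

  -- The default of `nthD` supplies the closing trigger `(ρ , σn)` at index `len`.
  tr : ℕ → Trigger
  tr = nthD (ρ , σn) mid

  Λ : ℕ → Trigger
  Λ = Λ∞ ρ mid σn

  -- `P k` holds the facts available to `tr k` in the first round, including the output of
  -- `(ρ , σuc)`.
  P F : ℕ → List Atom
  P = Fseq (Dρ ρ ++ outhc hc (ρ , σuc)) hc tr
  F = Fseq (Dρ ρ) hc Λ

  tr∈ : ∀ k → tr k ∈ mid ∷ʳ (ρ , σn)
  tr∈ = nthD∈∷ʳ (ρ , σn) mid

  rule∈ : ∀ k → proj₁ (tr k) ∈ R
  rule∈ k = proj₁ (rt (there (tr∈ k)))

  loaded-tr : ∀ {k} → k ≤ len → Loaded (tr k) ⟦ P k ⟧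
  loaded-tr = loadedList-nth mid (ρ , σn) (proj₂ ll)

  loaded-σn : Loaded (ρ , σn) ⟦ P len ⟧
  loaded-σn = subst (λ tr → Loaded tr ⟦ P len ⟧) (nthD-length (ρ , σn) mid) (loaded-tr ≤-refl)

  good-P : ∀ {k} → k ≤ len → GoodFacts (P k)
  good-P {zero}  _  = goodFacts-++ (goodFacts-rule-database ρ)
    (goodFacts-out {σ = σuc} {L = Dρ ρ} ρ∈ (goodFacts-rule-database ρ) (proj₁ ll))
  good-P {suc k} k≤ = goodFacts-++ (good-P k≤')
    (goodFacts-out {σ = proj₂ (tr k)} {L = P k} (rule∈ k) (good-P k≤') (loaded-tr k≤'))
    where k≤' = ≤-trans (n≤1+n k) k≤

  good-σn : ∀ {x} → x ∈ bodyVars ρ → Good (σn x)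
  good-σn x∈ = good-P ≤-refl (loaded-term {ψ = ρ} {σn} {P len} loaded-σn x∈)

  good-tr : ∀ {k} → k ≤ len → ∀ {x} → x ∈ bodyVars (proj₁ (tr k)) → Good (proj₂ (tr k) x)
  good-tr {k} k≤ x∈ = good-P k≤ (loaded-term {ψ = proj₁ (tr k)} {proj₂ (tr k)} {P k} (loaded-tr k≤) x∈)

  g-body : ∀ {x} → x ∈ bodyVars ρ → applyC g (const (cvar x)) ≡ σn x
  g-body {x} x∈ = cong (λ b → fromMaybe (const (cvar x)) (if b then just (σn x) else nothing))
    (dec-true (x ∈v? bodyVars ρ) x∈)

  g^-body : ∀ j {x} → x ∈ bodyVars ρ → g^ (suc j) (σuc x) ≡ g^ j (σn x)
  g^-body j x∈ = trans (iterC-suc j g _) (cong (g^ j) (g-body x∈))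

  g-good : ∀ x → Good (applyC g (const (cvar x)))
  g-good x with x ∈v? bodyVars ρ
  ... | yes x∈ = good-σn x∈
  ... | no  _  = cvarG

  index-mod : ∀ j {k} → k ≤ len → (k + j * n) % n ≡ k
  index-mod j {k} k≤ = trans ([m+kn]%n≡m%n k j n) (m≤n⇒m%n≡m k≤)

  index-div : ∀ j {k} → k ≤ len → (k + j * n) / n ≡ j
  index-div j {k} k≤ =
    trans (+-distrib-/-∣ʳ k (n∣m*n j)) (cong₂ _+_ (m<n⇒m/n≡0 (s≤s k≤)) (m*n/n≡m j n))

  Λ-index : ∀ j {k} → k ≤ len → Λ (suc (k + j * n)) ≡ (proj₁ (tr k) , g^ j ∘ proj₂ (tr k))
  Λ-index j {k} k≤ = cong₂ (λ i k → proj₁ (tr k) , g^ i ∘ proj₂ (tr k)) (index-div j k≤) (index-mod j k≤)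

  -- Round `j` repeats the prefix under `g^ j`. A new round needs no separate start: on the body of
  -- `ρ`, `g^ (suc j) ∘ σuc` coincides with `g^ j ∘ σn`, whose trigger closed the previous round.
  image : ∀ j k → k ≤ len → ∀ {a} → a ∈ P k → mapAtom (g^ j) a ∈ F (suc (k + j * n))
  image zero zero _ {a} a∈ = subst (_∈ F 1) (cong (atom (pred a)) (sym (map-id (args a)))) a∈
  image j (suc k) k≤ {a} a∈ with ∈-++⁻ (P k) a∈
  ... | inj₁ a∈P   = ∈-++⁺ˡ (image j k (≤-trans (n≤1+n k) k≤) a∈P)
  ... | inj₂ a∈out = ∈-++⁺ʳ (F (suc (k + j * n))) (subst (mapAtom (g^ j) a ∈_)
    (trans (out-hom (iterC-hom j g) (proj₁ (tr k)) (hc (proj₁ (tr k))) (proj₂ (tr k)))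
           (cong (outhc hc) (sym (Λ-index j (≤-trans (n≤1+n k) k≤)))))
    (∈-map⁺ (mapAtom (g^ j)) a∈out))
  image (suc j) zero _ {a} a∈ with ∈-++⁻ (Dρ ρ) a∈
  ... | inj₂ a∈out = ∈-++⁺ʳ (F (suc (len + j * n))) (subst (mapAtom (g^ (suc j)) a ∈_)
    (begin
      map (mapAtom (g^ (suc j))) (outhc hc (ρ , σuc)) ≡⟨ out-hom (iterC-hom (suc j) g) ρ (hc ρ) σuc ⟩
      outhc hc (ρ , g^ (suc j) ∘ σuc)
        ≡⟨ out-cong ρ∈ (hch ρ∈) (λ x∈ → g^-body j (frontier⊆body ρ x∈)) ⟩
      outhc hc (ρ , g^ j ∘ σn)                        ≡⟨ cong (λ tr → outhc hc (proj₁ tr , g^ j ∘ proj₂ tr))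
                                                              (sym (nthD-length (ρ , σn) mid)) ⟩
      outhc hc (proj₁ (tr len) , g^ j ∘ proj₂ (tr len)) ≡⟨ cong (outhc hc) (sym (Λ-index j ≤-refl)) ⟩
      outhc hc (Λ (suc (len + j * n)))                ∎)
    (∈-map⁺ (mapAtom (g^ (suc j))) a∈out))
    where open ≡-Reasoning
  -- Facts of the rule-database become body facts of the closing trigger, which was loaded at the
  -- end of the previous round.
  ... | inj₁ a∈D with ∈-map⁻ (substAtom σuc) a∈D
  ...   | b , b∈ , refl = ∈-++⁺ˡ (subst (_∈ F (suc (len + j * n)))
    (cong (atom (pred b)) (trans (sym (map-∘ (args b)))
      (trans (map-cong-∈ (args b) λ x∈ → sym (g^-body j (concatMap⁺ b∈ x∈))) (map-∘ (args b)))))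
    (image j len ≤-refl (loaded-σn (∈-map⁺ (substAtom σn) b∈))))

  mod≤ : ∀ m → m % n ≤ len
  mod≤ m = s≤s⁻¹ (m%n<n m n)

  loaded-Λ : ∀ i → Loaded (Λ i) ⟦ F i ⟧
  loaded-Λ zero    = proj₁ ll
  loaded-Λ (suc m) = subst (λ i → Loaded (Λ (suc m)) ⟦ F (suc i) ⟧) (sym (m≡m%n+[m/n]*n m n))
    (loaded-map {proj₁ (tr k)} {proj₂ (tr k)} {⟦ P k ⟧} (g^ (m / n))
      (image (m / n) k (mod≤ m)) (loaded-tr (mod≤ m)))
    where k = m % n

  ex⇒¬datalog : ∀ ψ {i y} → i < branching ψ → y ∈ exVarsAt ψ i → ¬ Datalog ψ
  ex⇒¬datalog ψ {i} {y} i< y∈ (one , noEx) with n<1⇒n≡0 (subst (i <_) one i<)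
  ... | refl with subst (y ∈_) noEx y∈
  ...   | ()

  -- The only trigger without a functional frontier term that may introduce functional terms is the first one.
  contains-frontier : ∀ {k} → k ≤ len → ∀ {t} → TermIn (P k) t → ¬ IsConst t →
                      ∀ {x} → x ∈ frontier ρ → const (cvar x) ⊑ t
  contains-frontier {zero} _ (a , a∈ , t∈) ¬c x∈ with ∈-++⁻ (Dρ ρ) a∈
  ... | inj₁ a∈D = let y , eq = rule-database-args ρ (a , a∈D , t∈) in contradiction (cvar y , eq) ¬c
  ... | inj₂ a∈out with termIn-out⁻ ρ (hc ρ) σuc (a , a∈out , t∈)
  ...   | z , z∈ , refl = sk-elim (λ t → ¬ IsConst t → const (cvar _) ⊑ t) ρ∈ (hch ρ∈) z∈
            (λ _ _ → under here (∈-map⁺ σuc x∈)) (λ _ ¬c → contradiction (_ , refl) ¬c) ¬c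
  contains-frontier {suc k} k≤ (a , a∈ , t∈) ¬c {x} x∈ with ∈-++⁻ (P k) a∈
  ... | inj₁ a∈P = contains-frontier (≤-trans (n≤1+n k) k≤) (a , a∈P , t∈) ¬c x∈
  ... | inj₂ a∈out with termIn-out⁻ (proj₁ (tr k)) (hc (proj₁ (tr k))) (proj₂ (tr k)) (a , a∈out , t∈)
  ...   | z , z∈ , refl = sk-elim (λ t → ¬ IsConst t → const (cvar x) ⊑ t) ψ∈ (hch ψ∈) z∈ fresh old ¬c
    where
    k≤' = ≤-trans (n≤1+n k) k≤
    ψ   = proj₁ (tr k)
    ψ∈  = rule∈ k

    old : ∀ {z} → z ∈ frontier ψ → ¬ IsConst (proj₂ (tr k) z) → const (cvar x) ⊑ proj₂ (tr k) z
    old z∈ ¬c = contains-frontier k≤'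
      (loaded-term {ψ = ψ} {proj₂ (tr k)} {P k} (loaded-tr k≤') (frontier⊆body ψ z∈)) ¬c x∈

    fresh : ∀ {f} → z ∈ exVarsAt ψ (hc ψ) → ¬ IsConst (fun f (map (proj₂ (tr k)) (frontier ψ))) →
            const (cvar x) ⊑ fun f (map (proj₂ (tr k)) (frontier ψ))
    fresh z∈ex _ =
      let y , y∈ , ¬cy = functional-frontier {σ = proj₂ (tr k)} (λ y∈ → good-tr k≤' (frontier⊆body ψ y∈)) ψ∈
                           (uc (tr∈ k)) (ex⇒¬datalog ψ (hch ψ∈) z∈ex)
      in under (old y∈ ¬cy) (∈-map⁺ (proj₂ (tr k)) y∈)

  cyclic⇒¬datalog : ¬ Datalog ρ
  cyclic⇒¬datalog = let _ , _ , _ , _ , t-cyclic = cyclic in go t-cyclic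
    where
    go : Cyclic ρ t → ¬ Datalog ρ
    go (_ , _ , _ , (refl , i< , y∈) , _) = ex⇒¬datalog ρ i< y∈

  growing-var : Σ Var λ x → x ∈ frontier ρ × ¬ IsConst (σn x)
  growing-var = functional-frontier {σ = σn} (λ x∈ → good-σn (frontier⊆body ρ x∈)) ρ∈
    (subst (UCUnblockable R hc) (nthD-length (ρ , σn) mid) (uc (tr∈ len))) cyclic⇒¬datalog

  x₀ : Var
  x₀ = proj₁ growing-var

  x₀∈ : x₀ ∈ bodyVars ρ
  x₀∈ = frontier⊆body ρ (proj₁ (proj₂ growing-var))

  -- `σn x₀` is functional and contains the constant of `x₀` properly. Applying `g^ (suc j)` turns
  -- that constant into `g^ j (σn x₀)`, so each iterate properly contains the one before.
  depth-grows : ∀ j → j ≤ depth (g^ j (σn x₀))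
  depth-grows zero    = z≤n
  depth-grows (suc j) = ≤-trans (s≤s (depth-grows j)) (go (σn x₀) refl
      (contains-frontier ≤-refl (loaded-term {ψ = ρ} {σn} {P len} loaded-σn x₀∈)
        (proj₂ (proj₂ growing-var)) (proj₁ (proj₂ growing-var))))
    where
    go : ∀ t → t ≡ σn x₀ → const (cvar x₀) ⊑ t → depth (g^ j (σn x₀)) < depth (g^ (suc j) t)
    go (const c)  eq here = contradiction (c , sym eq) (proj₂ (proj₂ growing-var))
    go (fun f ts) eq (under {u = s} x₀⊑ s∈) =
      subst (λ t → depth (g^ j (σn x₀)) < depth t) (sym (iterC-hom (suc j) g f ts))
        (s≤s (≤-trans below (depth≤depths (∈-map⁺ (g^ (suc j)) s∈))))
      where
      below : depth (g^ j (σn x₀)) ≤ depth (g^ (suc j) s)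
      below = subst (λ t → depth t ≤ depth (g^ (suc j) s)) (g^-body j x₀∈)
        (⊑-depth (⊑-hom (iterC-hom (suc j) g) x₀⊑))

  unbounded : ∀ N → Σ ℕ λ i → N < i × Σ Term λ t → TermIn (F i) t × N < depth t
  unbounded N with loaded-term {ψ = ρ} {σn} {P len} loaded-σn x₀∈
  -- The stage just before the closing trigger of round `suc N`, whose body mentions the deep term.
  ... | a , a∈ , t∈ = suc (len + suc N * n) ,
    s≤s (≤-trans (n≤1+n N) (≤-trans (m≤m*n (suc N) n) (m≤n+m (suc N * n) len))) ,
    g^ (suc N) (σn x₀) ,
    (mapAtom (g^ (suc N)) a , image (suc N) len ≤-refl a∈ , ∈-map⁺ (g^ (suc N)) t∈) ,
    depth-grows (suc N)

  termDepth : List Atom → ℕ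
  termDepth L = depths (concatMap args L)

  depth≤termDepth : ∀ {L t} → TermIn L t → depth t ≤ termDepth L
  depth≤termDepth (a , a∈ , t∈) = depth≤depths (concatMap⁺ {f = args} a∈ t∈)

  growing : ∀ i → Σ ℕ λ j → i < j × Σ Term λ t → TermIn (F j) t × ¬ TermIn (F i) t
  growing i with unbounded (i ⊔ termDepth (F i))
  ... | j , N<j , t , t∈ , N<t = j , ≤-trans (s≤s (m≤m⊔n i _)) N<j , t , t∈ , λ t∈i →
    <-irrefl refl (≤-trans N<t (≤-trans (depth≤termDepth {F i} t∈i) (m≤n⊔m i _)))

  -- Powers of `g` on the skeleton of a trigger.

  module Iterates {k : ℕ} (k≤ : k ≤ len) where

    ψ : Rule
    ψ = proj₁ (tr k)

    σ^ : ℕ → Subst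
    σ^ j x = g^ j (proj₂ (tr k) x)

    good^ : ∀ j {x} → x ∈ frontier ψ → Good (σ^ j x)
    good^ j x∈ = good-iterC g-good j (good-tr k≤ (frontier⊆body ψ x∈))

    module Sk (j : ℕ) = Skeleton ψ (σ^ j) (good^ j)

    S : ℕ → Term → Set
    S j = Skel (ψ , σ^ j)

    rev^ : ∀ j → Reversible g (S j)
    rev^ = rev (tr∈ k)

    skel-suc : ∀ j {t} → S j t → S (suc j) (applyC g t)
    skel-suc j (inj₁ (a , a∈ , t∈)) with concatMap⁻ {f = birthT ∘ σ^ j} a∈
    ... | x , x∈ , a∈x = Sk.birthT-skel (suc j)
      (mapAtom (applyC g) a , birth-applyC (good^ j x∈) a∈x , ∈-map⁺ (applyC g) t∈) x∈
    skel-suc j (inj₂ (x , x∈ , refl , _)) = Sk.skel-frontier (suc j) x∈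

    skel^ : ∀ j {t} → S 0 t → S j (g^ j t)
    skel^ zero    s = s
    skel^ (suc j) s = skel-suc j (skel^ j s)

    -- Reversibility concerns one application of `g`, but on the skeleton of every iterate, so the
    -- applications can be peeled off one by one.
    inj^ : ∀ j {t u} → S 0 t → S 0 u → g^ j t ≡ g^ j u → t ≡ u
    inj^ zero    s s' eq = eq
    inj^ (suc j) s s' eq = inj^ j s s' (proj₁ (proj₂ (rev^ j)) (skel^ j s) (skel^ j s') eq)

    -- If the visible term is not a subterm, then a sibling of it is. The corresponding sibling of
    -- `fun f ss` also lies in the skeleton, and reversibility is violated there.
    fun∉vis-const : ∀ j {f ss x} → S j (fun f ss) → S j (const (cvar x)) →
                    ¬ applyC g (fun f ss) ∈ vis (applyC g (const (cvar x)))
    fun∉vis-const j {f} {ss} {x} s sc t∈ with vis-sub (g-good x) t∈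
    ... | inj₁ t⊑ = proj₂ (proj₂ (rev^ j)) s sc t⊑
    ... | inj₂ (ψ' , i , y , z , ss' , eq , f⊑ , y∈ex , y∈) with fun-injˡ eq | fun-injʳ eq
    ...   | refl | refl with Sk.skel-good j s
    ...     | funG τ _ _ _ _ refl _ = proj₂ (proj₂ (rev^ j))
      (subst (S j) (sk-ex ψ' i τ y∈ex) (Sk.skel-sk j s y∈)) sc f⊑

    -- Either the visible term is the image of a term visible one power earlier, which injectivity
    -- identifies with `g^ j (fun f ss)`, or it lies in the image of a visible constant, which
    -- `fun∉vis-const` excludes.
    sep^ : ∀ j {f ss c} → S 0 (fun f ss) → S 0 (const c) → ¬ g^ j (fun f ss) ∈ vis (g^ j (const c))
    sep^ zero    s sc (here ())
    sep^ (suc j) {f} {ss} s sc t∈ with vis-applyC g-good (Sk.skel-good j (skel^ j sc)) t∈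
    ... | inj₁ (u , u∈ , eq) = sep^ j s sc (subst (_∈ vis (g^ j (const _)))
      (sym (proj₁ (proj₂ (rev^ j)) (skel^ j s) (Sk.skel-vis j (skel^ j sc) u∈) eq)) u∈)
    ... | inj₂ (x , c∈ , t∈x) = fun∉vis-const j (subst (S j) (iterC-hom j g f ss) (skel^ j s))
      (Sk.skel-vis j (skel^ j sc) c∈)
      (subst (λ t → applyC g t ∈ vis (applyC g (const (cvar x)))) (iterC-hom j g f ss) t∈x)

  -- Absence of leaves and g-unblockability.

  module _ {T : Tree} (ct : ChaseTree R (Dρ ρ) T) where

    open Branch wf hch ρ∈ ct

    Λ-obsolete⇒out : ∀ m {v} → OnBranch hc T v → Obsolete (Λ (suc m)) ⟦ L v ⟧ →
                     ∀ {a} → a ∈ outhc hc (Λ (suc m)) → a ∈ L v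
    Λ-obsolete⇒out m = obsolete⇒out {σ₁ = proj₂ (tr (m % n))} (rule∈ (m % n)) (good^ 0) (g^ (m / n))
        (iterC-hom (m / n) g) (good-iterC g-good (m / n)) (inj^ (m / n)) (sep^ (m / n)) (uc (tr∈ (m % n)))
      where open Iterates {m % n} (mod≤ m)

    -- Fairness only speaks about infinite branches, and whether a branch ends in a leaf is undecidable.
    -- So leaves are excluded first: a leaf would contain all of the (infinite) sequence.
    noLeaf : ∀ {v} → OnBranch hc T v → ¬ trig T v ≡ nothing
    noLeaf {v} b stop with unbounded (termDepth (L v))
    ... | i , _ , t , (a , a∈ , t∈) , N<t =
      <-irrefl refl (≤-trans N<t (depth≤termDepth {L v} (a , F⊆label i a∈ , t∈)))
      where
      F⊆label : ∀ i {a} → a ∈ F i → a ∈ L v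
      F⊆label zero a∈ = extends-label (leaf-extends b stop broot) a∈
      F⊆label (suc i) a∈ with ∈-++⁻ (F i) a∈
      ... | inj₁ a∈F = F⊆label i a∈F
      F⊆label (suc zero) a∈ | inj₂ a∈out with gu T ct b (loaded-mono {ρ , σuc} (F⊆label 0) (loaded-Λ 0))
      ... | w , b' , out⊆ = extends-label (leaf-extends b stop b') (out⊆ a∈out)
      -- A leaf satisfies all rules, so a loaded trigger is obsolete there and its output is
      -- present.
      F⊆label (suc (suc m)) a∈ | inj₂ a∈out = Λ-obsolete⇒out m b
        (proj₂ (ChaseTree.leaf ct (vertex b) stop) (rule∈ (m % n)) _
          (loaded-mono {Λ (suc m)} (F⊆label (suc m)) (loaded-Λ (suc m)))) a∈out

    open Infinite noLeaf public

  rtrigger-Λ : ∀ m → RTrigger R (Λ (suc m))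
  rtrigger-Λ m = rule∈ (m % n) , λ x∈ → good-termOver (good-iterC g-good (m / n) (good-tr (mod≤ m) x∈))

  -- As the branch is infinite, fairness makes a loaded trigger obsolete at some later vertex, and
  -- there obsoleteness entails that its output is present.
  unblockable : ∀ i → GUnblockable R (Dρ ρ) hc (Λ i)
  unblockable zero    = gu
  unblockable (suc m) T ct {v} b l =
    let w , b' , obs = fair-path ct {v} {Λ (suc m)} b (rtrigger-Λ m) l
    in w , b' , Λ-obsolete⇒out ct m {w} b' obs

theorem3 : (R : List Rule) (hc : Rule → ℕ) (ρ : Rule) (mid : List Trigger) (σn : Subst) →
    (∀ {ρ'} → ρ' ∈ R → WFRule ρ') → HeadChoice R hc → ρ ∈ R →
    CyclicityPrefix R hc ρ mid σn →
    CyclicitySequence R (Dρ ρ) hc (Λ∞ ρ mid σn) × NeverTerminates R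
theorem3 R hc ρ mid σn wf hch ρ∈ (rt , ll , uc , gu , cyclic , rev) =
  (loaded-Λ , growing , unblockable) , Dρ ρ , database , λ { (T , ct , fin) → ¬finite ct fin }
  where
  open Prefix wf hch ρ∈ mid σn rt ll uc gu cyclic rev

  database : Database (Dρ ρ)
  database a∈ t∈ = let x , eq = Chase.rule-database-args wf hch ρ (_ , a∈ , t∈) in cvar x , eq
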